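{- Let $b\ge3$ be odd, $n$ an even positive integer, and $K$ the transition matrix of the balanced carries chain on $\{ -\tfrac n2,\dots,\tfrac n2\}$. Then for $0\le j\le n$, \[ \lim_{r\to\infty}K^r(0,j-n/2)=\frac{\overline{A(n,j)}}{2^n n!}. \]
   Context: Balanced digits base $b$ ($b$ odd) are the integers $-\tfrac{b-1}{2},\dots,\tfrac{b-1}{2}$. When $n$ numbers in balanced digits are added column by column from right to left, if the carry into a column is $i$ and the column digits are $X_1,\dots,X_n$, the carry out is the unique integer $j$ with $jb-\tfrac{b-1}{2}\le i+X_1+\cdots+X_n\le jb+\tfrac{b-1}{2}$; the first carry is $0$. With all digits independent and uniform, the carries form a Markov chain (the balanced carries chain) with state space $\{ -\tfrac n2,\dots,\tfrac n2\}$ for $n$ even, transition matrix $K$, and $K^r$ its $r$-step transition matrix. A signed permutation on $n$ symbols is a bijection $\sigma$ of $\{\pm1,\dots,\pm n\}$ with $\sigma(-k)=-\sigma(k)$, written $\sigma(1)\cdots\sigma(n)$; with the order $1<2<\cdots<n<-n<\cdots<-1$, $\sigma$ has a descent at $i\in\{1,\dots,n-1\}$ if $\sigma(i)>\sigma(i+1)$ and a descent at $n$ if $\sigma(n)<0$. $\overline{A(n,k)}$ is the number of signed permutations on $n$ symbols with exactly $k$ descents. -}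

module Defs where

open import Data.Bool using (Bool; true; false; _∧_; _∨_; not; if_then_else_)
open import Data.Nat as ℕ using (ℕ; zero; suc)
open import Data.Integer as ℤ using (ℤ; +_; -_)
open import Data.Rational as ℚ using (ℚ; 0ℚ)
open import Data.List using (List; []; _∷_; map; concatMap; length; filter; foldr)
open import Data.Bool.ListAction using (any; all)
open import Relation.Nullary.Decidable using (T?)
open import Relation.Nullary.Decidable using (does)

range : ℤ → ℕ → List ℤ
range a zero = []
range a (suc len) = a ∷ range (a ℤ.+ + 1) len

tuples : {A : Set} → ℕ → List A → List (List A)
tuples zero xs = [] ∷ []
tuples (suc n) xs = concatMap (λ x → map (x ∷_) (tuples n xs)) xs

count : {A : Set} → (A → Bool) → List A → ℕ
count p xs = length (filter (λ x → T? (p x)) xs)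

sumℤ : List ℤ → ℤ
sumℤ = foldr ℤ._+_ (+ 0)

_≤ᵇ_ : ℤ → ℤ → Bool
x ≤ᵇ y = does (x ℤ.≤? y)

-- p / d as a rational (d is always nonzero where used)
infixl 7 _÷ℕ_
_÷ℕ_ : ℤ → ℕ → ℚ
p ÷ℕ zero = 0ℚ
p ÷ℕ suc d = p ℚ./ suc d

digits : ℕ → List ℤ
digits b = range (- (+ ℕ.⌊ b /2⌋)) b

-- One-step transition probability K(i,j) of the balanced carries chain
-- adding n numbers in base b: probability over uniform independent digits
-- X_1..X_n that  j b - (b-1)/2 ≤ i + X_1 + ... + X_n ≤ j b + (b-1)/2.
K : (b n : ℕ) → ℤ → ℤ → ℚ
K b n i j =
  (+ count (λ X → ((j ℤ.* + b) ℤ.- + c) ≤ᵇ (i ℤ.+ sumℤ X)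
                 ∧ (i ℤ.+ sumℤ X) ≤ᵇ ((j ℤ.* + b) ℤ.+ + c))
           (tuples n (digits b)))
  ÷ℕ (b ℕ.^ n)
  where c = ℕ.⌊ b /2⌋

states : ℕ → List ℤ
states n = range (- (+ ℕ.⌊ n /2⌋)) (suc n)

sumℚ : List ℚ → ℚ
sumℚ = foldr ℚ._+_ 0ℚ

Kpow : (b n : ℕ) → ℕ → ℤ → ℤ → ℚ
Kpow b n zero i j = if does (i ℤ.≟ j) then ℚ.1ℚ else 0ℚ
Kpow b n (suc r) i j = sumℚ (map (λ k → Kpow b n r i k ℚ.* K b n k j) (states n))

-- Signed permutations on n symbols, represented by the word σ(1)...σ(n)
-- (a list of integers); σ is determined by these values via σ(-k) = -σ(k).
-- A word is a signed permutation iff each entry has absolute value in 1..n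
-- and the absolute values are pairwise distinct.
distinct : List ℕ → Bool
distinct [] = true
distinct (x ∷ xs) = not (any (λ y → does (x ℕ.≟ y)) xs) ∧ distinct xs

isSignedPerm : ℕ → List ℤ → Bool
isSignedPerm n w =
  (length w ℕ.≡ᵇ n)
  ∧ all (λ x → (1 ℕ.≤ᵇ ℤ.∣ x ∣) ∧ (ℤ.∣ x ∣ ℕ.≤ᵇ n)) w
  ∧ distinct (map ℤ.∣_∣ w)

signedPerms : ℕ → List (List ℤ)
signedPerms n = filter (λ w → T? (isSignedPerm n w))
                       (tuples n (range (- (+ n)) (suc (2 ℕ.* n))))

-- order 1 < 2 < ... < n < -n < ... < -1 realised by a key:
-- x ↦ x for x > 0, and x ↦ 2n+1+x for x < 0
key : ℕ → ℤ → ℤ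
key n x = if (+ 0) ≤ᵇ x then x else (x ℤ.+ + (2 ℕ.* n ℕ.+ 1))

desc : ℕ → List ℤ → ℕ
desc n [] = 0
desc n (x ∷ []) = if (+ 0) ≤ᵇ x then 0 else 1
desc n (x ∷ y ∷ w) =
  (if key n x ≤ᵇ key n y then 0 else 1) ℕ.+ desc n (y ∷ w)

Abar : ℕ → ℕ → ℕ
Abar n k = count (λ w → desc n w ℕ.≡ᵇ k) (signedPerms n)

module Submission where

-- After r columns the n addends are independent uniform digits in base N = b^r, so K^r(0,j) N^n
-- counts the n-tuples of base-N digits whose sum lies in a window of N consecutive integers.
-- That count is a value of the (n+1)-fold convolution of the indicator of {0,…,N-1}, a discrete
-- B-spline.  It obeys a de Boor recurrence in n whose leading terms as N → ∞ are the
-- recurrence of the type B Eulerian numbers.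
-- Deleting ±s from a signed arrangement, s being the least absolute value, shows that the
-- descent numbers obey the same recurrence: s and -s are the extreme letters of the order
-- 1 < … < n < -n < … < -1.

open import Defs
open import Data.Bool using (Bool; true; false; _∧_; not; if_then_else_; T)
open import Data.Bool.ListAction using (any; all)
open import Data.Unit using (tt)
open import Data.Nat as ℕ using (ℕ; zero; suc; _!; ⌊_/2⌋)
import Data.Nat.Properties as ℕₚ
open import Data.Nat.Coprimality using (Coprime)
import Data.Nat.Tactic.RingSolver as ℕ-Ring
open import Data.Integer as ℤ using (ℤ; +_; -[1+_]; -_; _+_; _*_; _-_)
open import Data.Integer.Properties as ℤₚ using (+-identityˡ; +-identityʳ; +-assoc; +-comm; *-zeroʳ; *-zeroˡ)
open import Data.Integer.DivMod using (_%ℕ_; _/ℕ_; a≡a%ℕn+[a/ℕn]*n; n%ℕd<d)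
open import Data.Integer.Tactic.RingSolver using (solve-∀)
open import Data.Rational as ℚ using (ℚ; 0ℚ; mkℚ)
import Data.Rational.Properties as ℚₚ
open import Data.Rational.Unnormalised as ℚᵘ using (mkℚᵘ; *≡*; *<*)
import Data.Rational.Unnormalised.Properties as ℚᵘₚ
open import Data.List using (List; []; _∷_; map; concatMap; length; filter; _++_)
open import Data.List.Relation.Unary.All as All using (All; []; _∷_)
open import Data.List.Relation.Unary.All.Properties using (map⁺)
open import Data.List.Relation.Unary.AllPairs using (AllPairs; []; _∷_)
open import Data.Product using (∃; ∃-syntax; _×_; _,_; proj₁; proj₂)
open import Data.Sum using (_⊎_; inj₁; inj₂)
open import Function using (_∘_; id)
open import Relation.Binary.PropositionalEquality
open import Relation.Nullary using (¬_; contradiction)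
open import Relation.Nullary.Decidable using (T?; yes; no; dec-true; dec-false)

-- The (n+1)st factor of the convolution is the window itself: i + X₁ + ⋯ + Xₙ - jb is a balanced
-- digit exactly when some further balanced digit cancels it. Type B enters through the
-- half-integers. With N = 2M + 1 and n = 2h, the spline is evaluated at -(jN + M - h), close to -(j
-- + 1/2)N. At multiples of N the recurrence would lead to the ordinary Eulerian numbers; the extra
-- half, once doubled, makes its coefficients odd. One doubling and one factor k per use of the
-- recurrence build up 2^n n!. The offset h stays fixed while N grows, so it only perturbs
-- lower-order terms, and each induction step keeps the relative error of order 1/N. The chain has
-- finitely many states, so composing columns also requires that no carry outside -n/2, ..., n/2
-- contributes; this is a bound on sums of n + 1 balanced digits.

cancel-bound : ∀ N d C P q r .{{_ : ℕ.NonZero P}} →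
  N ℕ.* d ℕ.≤ C ℕ.* P → C ℕ.* q ℕ.≤ r → r ℕ.< N → d ℕ.* q ℕ.< P
cancel-bound N d C P q r Nd≤CP Cq≤r r<N = ℕₚ.*-cancelˡ-< N (d ℕ.* q) P (begin-strict
  N ℕ.* (d ℕ.* q)  ≡⟨ sym (ℕₚ.*-assoc N d q) ⟩
  N ℕ.* d ℕ.* q    ≤⟨ ℕₚ.*-monoˡ-≤ q Nd≤CP ⟩
  C ℕ.* P ℕ.* q    ≡⟨ swap C P q ⟩
  C ℕ.* q ℕ.* P    ≤⟨ ℕₚ.*-monoˡ-≤ P Cq≤r ⟩
  r ℕ.* P          <⟨ ℕₚ.*-monoˡ-< P r<N ⟩
  N ℕ.* P          ∎)
  where
  open ℕₚ.≤-Reasoning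
  swap : ∀ C P q → C ℕ.* P ℕ.* q ≡ C ℕ.* q ℕ.* P
  swap = ℕ-Ring.solve-∀

open ≡-Reasoning

-- Finite sums over lists and arithmetic progressions

variable
  A B : Set

+-inter : ∀ a b c d → (a + b) + (c + d) ≡ (a + c) + (b + d)
+-inter = solve-∀

∑ : List A → (A → ℤ) → ℤ
∑ xs f = sumℤ (map f xs)

∑-congAll : {xs : List A} {f g : A → ℤ} → All (λ x → f x ≡ g x) xs → ∑ xs f ≡ ∑ xs g
∑-congAll []       = refl
∑-congAll (p ∷ ps) = cong₂ _+_ p (∑-congAll ps)

∑-cong : (xs : List A) {f g : A → ℤ} → (∀ x → f x ≡ g x) → ∑ xs f ≡ ∑ xs g
∑-cong []       p = refl
∑-cong (x ∷ xs) p = cong₂ _+_ (p x) (∑-cong xs p)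

∑-zero : (xs : List A) → ∑ xs (λ _ → + 0) ≡ + 0
∑-zero []       = refl
∑-zero (x ∷ xs) = trans (+-identityˡ _) (∑-zero xs)

∑-+ : (xs : List A) (f g : A → ℤ) → ∑ xs (λ x → f x + g x) ≡ ∑ xs f + ∑ xs g
∑-+ []       f g = refl
∑-+ (x ∷ xs) f g = trans (cong (_+_ (f x + g x)) (∑-+ xs f g)) (+-inter (f x) (g x) _ _)

∑-*ˡ : (xs : List A) (c : ℤ) (f : A → ℤ) → ∑ xs (λ x → c * f x) ≡ c * ∑ xs f
∑-*ˡ []       c f = sym (*-zeroʳ c)
∑-*ˡ (x ∷ xs) c f = trans (cong (_+_ (c * f x)) (∑-*ˡ xs c f)) (sym (ℤₚ.*-distribˡ-+ c (f x) _))

∑-swap : (xs : List A) (ys : List B) (f : A → B → ℤ) →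
  ∑ xs (λ x → ∑ ys (f x)) ≡ ∑ ys (λ y → ∑ xs (λ x → f x y))
∑-swap []       ys f = sym (∑-zero ys)
∑-swap (x ∷ xs) ys f = trans (cong (_+_ (∑ ys (f x))) (∑-swap xs ys f)) (sym (∑-+ ys _ _))

∑-++ : (xs ys : List A) (f : A → ℤ) → ∑ (xs ++ ys) f ≡ ∑ xs f + ∑ ys f
∑-++ []       ys f = sym (+-identityˡ _)
∑-++ (x ∷ xs) ys f = trans (cong (_+_ (f x)) (∑-++ xs ys f)) (sym (+-assoc (f x) _ _))

∑-map : (h : A → B) (xs : List A) (f : B → ℤ) → ∑ (map h xs) f ≡ ∑ xs (f ∘ h)
∑-map h []       f = refl
∑-map h (x ∷ xs) f = cong (_+_ (f (h x))) (∑-map h xs f)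

∑-concatMap : (h : A → List B) (xs : List A) (f : B → ℤ) →
  ∑ (concatMap h xs) f ≡ ∑ xs (λ x → ∑ (h x) f)
∑-concatMap h []       f = refl
∑-concatMap h (x ∷ xs) f =
  trans (∑-++ (h x) (concatMap h xs) f) (cong (_+_ (∑ (h x) f)) (∑-concatMap h xs f))

∑-tuples : (m : ℕ) (xs : List A) (f : List A → ℤ) →
  ∑ (tuples (suc m) xs) f ≡ ∑ xs (λ x → ∑ (tuples m xs) (λ w → f (x ∷ w)))
∑-tuples m xs f = trans (∑-concatMap _ xs f) (∑-cong xs (λ x → ∑-map (x ∷_) (tuples m xs) f))

⟦_⟧ : Bool → ℤ
⟦ true ⟧  = + 1
⟦ false ⟧ = + 0

⟦⟧-∧ : ∀ a b → ⟦ a ∧ b ⟧ ≡ ⟦ a ⟧ * ⟦ b ⟧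
⟦⟧-∧ true  b = sym (ℤₚ.*-identityˡ _)
⟦⟧-∧ false b = sym (*-zeroˡ ⟦ b ⟧)

∑-filter : (p : A → Bool) (xs : List A) (f : A → ℤ) →
  ∑ (filter (λ x → T? (p x)) xs) f ≡ ∑ xs (λ x → ⟦ p x ⟧ * f x)
∑-filter p []       f = refl
∑-filter p (x ∷ xs) f with p x
... | true  = cong₂ _+_ (sym (ℤₚ.*-identityˡ (f x))) (∑-filter p xs f)
... | false = trans (∑-filter p xs f) (trans (sym (+-identityˡ _))
  (cong (_+ ∑ xs (λ x → ⟦ p x ⟧ * f x)) (sym (*-zeroˡ (f x)))))

+count≡∑ : (p : A → Bool) (xs : List A) → + count p xs ≡ ∑ xs (λ x → ⟦ p x ⟧)
+count≡∑ p []       = refl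
+count≡∑ p (x ∷ xs) with p x
... | true  = cong (_+_ (+ 1)) (+count≡∑ p xs)
... | false = trans (+count≡∑ p xs) (sym (+-identityˡ _))

δ : ℤ → ℤ
δ (+ zero)   = + 1
δ (+ suc _)  = + 0
δ -[1+ _ ]   = + 0

z*δ[z]≡0 : ∀ z → z * δ z ≡ + 0
z*δ[z]≡0 (+ zero)  = refl
z*δ[z]≡0 (+ suc n) = *-zeroʳ (+ suc n)
z*δ[z]≡0 -[1+ n ]  = *-zeroʳ -[1+ n ]

δ-≢0 : ∀ z → ¬ (z ≡ + 0) → δ z ≡ + 0
δ-≢0 (+ zero)  p = contradiction refl p
δ-≢0 (+ suc n) p = refl
δ-≢0 -[1+ n ]  p = refl

∑-tail : ∀ (u h : ℤ) k → u + h + k * h ≡ u + (+ 1 + k) * h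
∑-tail = solve-∀

S : ℤ → ℕ → (ℤ → ℤ) → ℤ → ℤ
S h zero    f u = + 0
S h (suc N) f u = f u + S h N f (u + h)

S-cong : ∀ h N {f g} → (∀ u → f u ≡ g u) → ∀ u → S h N f u ≡ S h N g u
S-cong h zero    p u = refl
S-cong h (suc N) p u = cong₂ _+_ (p u) (S-cong h N p (u + h))

S-zero : ∀ h N u → S h N (λ _ → + 0) u ≡ + 0
S-zero h zero    u = refl
S-zero h (suc N) u = trans (+-identityˡ _) (S-zero h N (u + h))

S-+ : ∀ h N f g u → S h N (λ v → f v + g v) u ≡ S h N f u + S h N g u
S-+ h zero    f g u = refl
S-+ h (suc N) f g u =
  trans (cong (_+_ (f u + g u)) (S-+ h N f g (u + h))) (+-inter (f u) (g u) _ _)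

S-*ˡ : ∀ h N c f u → S h N (λ v → c * f v) u ≡ c * S h N f u
S-*ˡ h zero    c f u = sym (*-zeroʳ c)
S-*ˡ h (suc N) c f u =
  trans (cong (_+_ (c * f u)) (S-*ˡ h N c f (u + h))) (sym (ℤₚ.*-distribˡ-+ c (f u) _))

S-shift : ∀ h N f v u → S h N (λ w → f (w + v)) u ≡ S h N f (u + v)
S-shift h zero    f v u = refl
S-shift h (suc N) f v u = cong (_+_ (f (u + v)))
  (trans (S-shift h N f v (u + h)) (cong (S h N f) (swap u h v)))
  where
  swap : ∀ a b c → a + b + c ≡ a + c + b
  swap = solve-∀

S-comm : ∀ h N k M f u → S h N (S k M f) u ≡ S k M (S h N f) u
S-comm h zero    k M f u = sym (S-zero k M u)
S-comm h (suc N) k M f u = begin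
  S k M f u + S h N (S k M f) (u + h)
    ≡⟨ cong (_+_ (S k M f u)) (S-comm h N k M f (u + h)) ⟩
  S k M f u + S k M (S h N f) (u + h)
    ≡⟨ cong (_+_ (S k M f u)) (sym (S-shift k M (S h N f) h u)) ⟩
  S k M f u + S k M (λ v → S h N f (v + h)) u
    ≡⟨ sym (S-+ k M f _ u) ⟩
  S k M (S h (suc N) f) u ∎

S-++ : ∀ h M N f u → S h (M ℕ.+ N) f u ≡ S h M f u + S h N f (u + + M * h)
S-++ h zero    N f u = trans (sym (+-identityˡ _))
  (cong (λ v → + 0 + S h N f v) (sym (trans (cong (_+_ u) (*-zeroˡ h)) (+-identityʳ u))))
S-++ h (suc M) N f u = begin
  f u + S h (M ℕ.+ N) f (u + h)
    ≡⟨ cong (_+_ (f u)) (S-++ h M N f (u + h)) ⟩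
  f u + (S h M f (u + h) + S h N f (u + h + + M * h))
    ≡⟨ sym (+-assoc (f u) _ _) ⟩
  f u + S h M f (u + h) + S h N f (u + h + + M * h)
    ≡⟨ cong (λ v → f u + S h M f (u + h) + S h N f v) (∑-tail u h (+ M)) ⟩
  f u + S h M f (u + h) + S h N f (u + (+ suc M) * h) ∎

-- The digits 0..bN-1 are the y + N x with y a digit in base N and x a digit in base b.
S-split : ∀ b N f u → S (+ 1) (b ℕ.* N) f u ≡ S (+ 1) N (S (+ N) b f) u
S-split zero    N f u = sym (S-zero (+ 1) N u)
S-split (suc b) N f u = begin
  S (+ 1) (N ℕ.+ b ℕ.* N) f u
    ≡⟨ S-++ (+ 1) N (b ℕ.* N) f u ⟩
  S (+ 1) N f u + S (+ 1) (b ℕ.* N) f (u + + N * + 1)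
    ≡⟨ cong (λ v → S (+ 1) N f u + S (+ 1) (b ℕ.* N) f (u + v)) (ℤₚ.*-identityʳ (+ N)) ⟩
  S (+ 1) N f u + S (+ 1) (b ℕ.* N) f (u + + N)
    ≡⟨ cong (_+_ (S (+ 1) N f u)) (S-split b N f (u + + N)) ⟩
  S (+ 1) N f u + S (+ 1) N (S (+ N) b f) (u + + N)
    ≡⟨ cong (_+_ (S (+ 1) N f u)) (sym (S-shift (+ 1) N (S (+ N) b f) (+ N) u)) ⟩
  S (+ 1) N f u + S (+ 1) N (λ v → S (+ N) b f (v + + N)) u
    ≡⟨ sym (S-+ (+ 1) N f _ u) ⟩
  S (+ 1) N (S (+ N) (suc b) f) u ∎

-- Both sides sum `f` over the N + 1 points u, ..., u + N. For `f` a spline this turns a difference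
-- at distance N into a unit difference one order higher.
S-telescope : ∀ N f u → S (+ 1) N f (u + + 1) + f u ≡ S (+ 1) N f u + f (u + + N)
S-telescope zero    f u = cong (λ v → + 0 + f v) (sym (+-identityʳ u))
S-telescope (suc N) f u = begin
  f (u + + 1) + S (+ 1) N f (u + + 1 + + 1) + f u
    ≡⟨ cong (_+ f u) (+-comm (f (u + + 1)) _) ⟩
  S (+ 1) N f (u + + 1 + + 1) + f (u + + 1) + f u
    ≡⟨ cong (_+ f u) (S-telescope N f (u + + 1)) ⟩
  S (+ 1) N f (u + + 1) + f (u + + 1 + + N) + f u
    ≡⟨ rot (S (+ 1) N f (u + + 1)) (f (u + + 1 + + N)) (f u) ⟩
  f u + S (+ 1) N f (u + + 1) + f (u + + 1 + + N)
    ≡⟨ cong (λ v → f u + S (+ 1) N f (u + + 1) + f v) (+-assoc u (+ 1) (+ N)) ⟩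
  f u + S (+ 1) N f (u + + 1) + f (u + + suc N) ∎
  where
  rot : ∀ a b c → a + b + c ≡ c + a + b
  rot = solve-∀

-- Iterated window sums and the discrete B-spline

It : ℤ → ℕ → ℕ → (ℤ → ℤ) → ℤ → ℤ
It h N zero    f = f
It h N (suc m) f = S h N (It h N m f)

It-cong : ∀ h N m {f g} → (∀ u → f u ≡ g u) → ∀ u → It h N m f u ≡ It h N m g u
It-cong h N zero    p = p
It-cong h N (suc m) p = S-cong h N (It-cong h N m p)

It-zero : ∀ h N m u → It h N m (λ _ → + 0) u ≡ + 0
It-zero h N zero    u = refl
It-zero h N (suc m) u = trans (S-cong h N (It-zero h N m) u) (S-zero h N u)

It-+ : ∀ h N m f g u → It h N m (λ v → f v + g v) u ≡ It h N m f u + It h N m g u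
It-+ h N zero    f g u = refl
It-+ h N (suc m) f g u = trans (S-cong h N (It-+ h N m f g) u) (S-+ h N _ _ u)

It-*ˡ : ∀ h N m c f u → It h N m (λ v → c * f v) u ≡ c * It h N m f u
It-*ˡ h N zero    c f u = refl
It-*ˡ h N (suc m) c f u = trans (S-cong h N (It-*ˡ h N m c f) u) (S-*ˡ h N c _ u)

It-∑ : ∀ h N m (xs : List A) (f : A → ℤ → ℤ) u →
  It h N m (λ v → ∑ xs (λ x → f x v)) u ≡ ∑ xs (λ x → It h N m (f x) u)
It-∑ h N m []       f u = It-zero h N m u
It-∑ h N m (x ∷ xs) f u = trans (It-+ h N m (f x) _ u) (cong (_+_ (It h N m (f x) u)) (It-∑ h N m xs f u))

It-shift : ∀ h N m f v u → It h N m (λ w → f (w + v)) u ≡ It h N m f (u + v)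
It-shift h N zero    f v u = refl
It-shift h N (suc m) f v u = trans (S-cong h N (It-shift h N m f v) u) (S-shift h N _ v u)

It-S-comm : ∀ h N m k M f u → It h N m (S k M f) u ≡ S k M (It h N m f) u
It-S-comm h N zero    k M f u = refl
It-S-comm h N (suc m) k M f u = trans (S-cong h N (It-S-comm h N m k M f) u) (S-comm h N k M _ u)

It-split : ∀ b N m f u → It (+ 1) (b ℕ.* N) m f u ≡ It (+ 1) N m (It (+ N) b m f) u
It-split b N zero    f u = refl
It-split b N (suc m) f u = begin
  S (+ 1) (b ℕ.* N) (It (+ 1) (b ℕ.* N) m f) u
    ≡⟨ S-split b N _ u ⟩
  S (+ 1) N (S (+ N) b (It (+ 1) (b ℕ.* N) m f)) u
    ≡⟨ S-cong (+ 1) N (S-cong (+ N) b (It-split b N m f)) u ⟩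
  S (+ 1) N (S (+ N) b (It (+ 1) N m (It (+ N) b m f))) u
    ≡⟨ S-cong (+ 1) N (λ v → sym (It-S-comm (+ 1) N m (+ N) b _ v)) u ⟩
  S (+ 1) N (It (+ 1) N m (S (+ N) b (It (+ N) b m f))) u ∎

∑-range : ∀ b a (f : ℤ → ℤ) → ∑ (range a b) f ≡ S (+ 1) b f a
∑-range zero    a f = refl
∑-range (suc b) a f = cong (_+_ (f a)) (∑-range b (a + + 1) f)

-- Each digit is a plus a number below b, so the n shifts by a collect in the argument.
∑-tuples-range : ∀ n a b (f : ℤ → ℤ) s →
  ∑ (tuples n (range a b)) (λ X → f (s + sumℤ X)) ≡ It (+ 1) b n f (s + + n * a)
∑-tuples-range zero    a b f s = trans (+-identityʳ _) (cong f (cong (_+_ s) (sym (*-zeroˡ a))))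
∑-tuples-range (suc n) a b f s = begin
  ∑ (tuples (suc n) (range a b)) (λ X → f (s + sumℤ X))
    ≡⟨ ∑-tuples n (range a b) _ ⟩
  ∑ (range a b) (λ x → ∑ (tuples n (range a b)) (λ X → f (s + (x + sumℤ X))))
    ≡⟨ ∑-cong (range a b) (λ x → trans
         (∑-cong (tuples n (range a b)) (λ X → cong f (sym (+-assoc s x (sumℤ X)))))
         (∑-tuples-range n a b f (s + x))) ⟩
  ∑ (range a b) (λ x → It (+ 1) b n f (s + x + + n * a))
    ≡⟨ ∑-cong (range a b) (λ x → cong (It (+ 1) b n f) (move s x (+ n * a))) ⟩
  ∑ (range a b) (λ x → It (+ 1) b n f (x + (s + + n * a)))
    ≡⟨ ∑-range b a _ ⟩
  S (+ 1) b (λ x → It (+ 1) b n f (x + (s + + n * a))) a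
    ≡⟨ S-shift (+ 1) b _ _ a ⟩
  S (+ 1) b (It (+ 1) b n f) (a + (s + + n * a))
    ≡⟨ cong (S (+ 1) b (It (+ 1) b n f)) (regroup a s (+ n)) ⟩
  S (+ 1) b (It (+ 1) b n f) (s + + suc n * a) ∎
  where
  move : ∀ s x c → s + x + c ≡ x + (s + c)
  move = solve-∀
  regroup : ∀ a s n → a + (s + n * a) ≡ s + (+ 1 + n) * a
  regroup = solve-∀

-- Counts the m-tuples from {0, ..., N-1} with sum -t: the argument is the negative of the sum, and
-- the support is -m(N-1) ≤ t ≤ 0.
spline : ℕ → ℕ → ℤ → ℤ
spline N m = It (+ 1) N m δ

-- The discrete B-spline recurrence

-- Abel summation against the linear weight u; the sum that remains runs over the window shifted by
-- one.
S-by-parts : ∀ N h t → S (+ 1) N (λ u → u * (h (u + + 1) - h u)) t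
  ≡ (t + + N) * h (t + + N) - t * h t - S (+ 1) N h (t + + 1)
S-by-parts zero    h t rewrite +-identityʳ t = lem (t * h t)
  where
  lem : ∀ a → + 0 ≡ a - a - + 0
  lem = solve-∀
S-by-parts (suc N) h t = begin
  t * (h (t + + 1) - h t) + S (+ 1) N (λ u → u * (h (u + + 1) - h u)) (t + + 1)
    ≡⟨ cong (_+_ (t * (h (t + + 1) - h t))) (S-by-parts N h (t + + 1)) ⟩
  t * (h (t + + 1) - h t) + ((t + + 1 + + N) * h (t + + 1 + + N)
    - (t + + 1) * h (t + + 1) - S (+ 1) N h (t + + 1 + + 1))
    ≡⟨ cong (λ v → t * (h (t + + 1) - h t) + (v * h v - (t + + 1) * h (t + + 1) - S (+ 1) N h (t + + 1 + + 1)))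
         (+-assoc t (+ 1) (+ N)) ⟩
  t * (h (t + + 1) - h t) + ((t + + suc N) * h (t + + suc N)
    - (t + + 1) * h (t + + 1) - S (+ 1) N h (t + + 1 + + 1))
    ≡⟨ lem t (h (t + + 1)) (h t) ((t + + suc N) * h (t + + suc N)) _ ⟩
  (t + + suc N) * h (t + + suc N) - t * h t - (h (t + + 1) + S (+ 1) N h (t + + 1 + + 1)) ∎
  where
  lem : ∀ t a b c s → t * (a - b) + (c - (t + + 1) * a - s) ≡ c - t * b - (a + s)
  lem = solve-∀

-- The discrete analogue of de Boor's recurrence for B-splines.
spline-recurrence : ∀ N k t → + k * spline N (suc k) t ≡
  (+ k - t) * spline N k t + ((+ 1 + + k) * + N + t - + k) * spline N k (t + + N)
spline-recurrence N zero t = begin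
  + 0 * spline N 1 t
    ≡⟨ *-zeroˡ (spline N 1 t) ⟩
  + 0
    ≡⟨ sym (cong₂ _+_ (cong -_ (z*δ[z]≡0 t)) (z*δ[z]≡0 (t + + N))) ⟩
  - (t * δ t) + (t + + N) * δ (t + + N)
    ≡⟨ lem t (+ N) (δ t) (δ (t + + N)) ⟩
  (+ 0 - t) * δ t + ((+ 1 + + 0) * + N + t - + 0) * δ (t + + N) ∎
  where
  lem : ∀ t n a b → - (t * a) + (t + n) * b ≡ (+ 0 - t) * a + ((+ 1 + + 0) * n + t - + 0) * b
  lem = solve-∀
spline-recurrence N (suc k) t = begin
  (+ 1 + κ) * R₂ t
    -- One copy of R₂ t is set aside: summation by parts produces -R₂ (t + 1), hence a -R₂ t that
    -- cancels it.
    ≡⟨ distrib κ (R₂ t) ⟩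
  κ * R₂ t + R₂ t
    ≡⟨ cong (_+ R₂ t) (sym (S-*ˡ (+ 1) N κ R₁ t)) ⟩
  Σ¹ (λ u → κ * R₁ u) t + R₂ t
    ≡⟨ cong (_+ R₂ t) (S-cong (+ 1) N step t) ⟩
  Σ¹ (λ u → (κ * R₀ u + γ * R₀ (u + ν)) + u * (R₁ (u + + 1) - R₁ u)) t + R₂ t
    ≡⟨ cong (_+ R₂ t) (S-+ (+ 1) N _ _ t) ⟩
  Σ¹ (λ u → κ * R₀ u + γ * R₀ (u + ν)) t + Σ¹ (λ u → u * (R₁ (u + + 1) - R₁ u)) t + R₂ t
    ≡⟨ cong₂ (λ a b → a + b + R₂ t)
         (trans (S-+ (+ 1) N _ _ t) (cong₂ _+_ (S-*ˡ (+ 1) N κ R₀ t)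
           (trans (S-*ˡ (+ 1) N γ _ t) (cong (γ *_) (S-shift (+ 1) N R₀ ν t)))))
         (S-by-parts N R₁ t) ⟩
  (κ * R₁ t + γ * R₁ (t + ν)) + ((t + ν) * R₁ (t + ν) - t * R₁ t - R₂ (t + + 1)) + R₂ t
    ≡⟨ cong (λ a → (κ * R₁ t + γ * R₁ (t + ν)) + ((t + ν) * R₁ (t + ν) - t * R₁ t - a) + R₂ t)
         (trans (isolate (R₂ (t + + 1)) (R₁ t)) (cong (_- R₁ t) (S-telescope N R₁ t))) ⟩
  (κ * R₁ t + γ * R₁ (t + ν)) + ((t + ν) * R₁ (t + ν) - t * R₁ t - (R₂ t + R₁ (t + ν) - R₁ t)) + R₂ t
    ≡⟨ collect κ ν t (R₁ t) (R₁ (t + ν)) (R₂ t) ⟩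
  ((+ 1 + κ) - t) * R₁ t + ((+ 1 + (+ 1 + κ)) * ν + t - (+ 1 + κ)) * R₁ (t + ν) ∎
  where
  κ ν γ : ℤ
  κ = + k
  ν = + N
  γ = (+ 1 + κ) * ν - κ
  Σ¹ = S (+ 1) N
  R₀ = spline N k
  R₁ = spline N (suc k)
  R₂ = spline N (suc (suc k))
  distrib : ∀ κ x → (+ 1 + κ) * x ≡ κ * x + x
  distrib = solve-∀
  isolate : ∀ a b → a ≡ a + b - b
  isolate = solve-∀
  collect : ∀ κ ν t x y z →
    (κ * x + ((+ 1 + κ) * ν - κ) * y) + ((t + ν) * y - t * x - (z + y - x)) + z
    ≡ ((+ 1 + κ) - t) * x + ((+ 1 + (+ 1 + κ)) * ν + t - (+ 1 + κ)) * y
  collect = solve-∀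
  split : ∀ κ ν u x y → (κ - u) * x + ((+ 1 + κ) * ν + u - κ) * y
    ≡ (κ * x + ((+ 1 + κ) * ν - κ) * y) + u * (y - x)
  split = solve-∀
  swap-sides : ∀ {a b c d} → a + b ≡ c + d → d - b ≡ a - c
  swap-sides {a} {b} {c} {d} p = trans (l₁ b c d) (trans (cong (λ x → x - c - b) (sym p)) (l₂ a b c))
    where
    l₁ : ∀ b c d → d - b ≡ c + d - c - b
    l₁ = solve-∀
    l₂ : ∀ a b c → a + b - c - b ≡ a - c
    l₂ = solve-∀
  -- The coefficients in the induction hypothesis are linear in u. Their u-dependent part multiplies
  -- R₀ (u + ν) - R₀ u, which `S-telescope` rewrites as a unit difference of R₁, the shape that
  -- `S-by-parts` can sum.
  step : ∀ u → κ * R₁ u ≡ (κ * R₀ u + γ * R₀ (u + ν)) + u * (R₁ (u + + 1) - R₁ u)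
  step u = begin
    κ * R₁ u
      ≡⟨ spline-recurrence N k u ⟩
    (κ - u) * R₀ u + ((+ 1 + κ) * ν + u - κ) * R₀ (u + ν)
      ≡⟨ split κ ν u (R₀ u) (R₀ (u + ν)) ⟩
    (κ * R₀ u + γ * R₀ (u + ν)) + u * (R₀ (u + ν) - R₀ u)
      ≡⟨ cong (λ v → (κ * R₀ u + γ * R₀ (u + ν)) + u * v)
           (swap-sides {R₁ (u + + 1)} {R₀ u} {R₁ u} (S-telescope N R₀ u)) ⟩
    (κ * R₀ u + γ * R₀ (u + ν)) + u * (R₁ (u + + 1) - R₁ u) ∎

-- Asymptotics of the discrete B-spline

S-δ-above : ∀ N i → S (+ 1) N δ (+ suc i) ≡ + 0
S-δ-above zero    i = refl
S-δ-above (suc N) i = trans (+-identityˡ _)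
  (trans (cong (λ k → S (+ 1) N δ (+ k)) (ℕₚ.+-comm (suc i) 1)) (S-δ-above N (suc i)))

S-δ-below : ∀ N i → S (+ 1) N δ (- + (N ℕ.+ i)) ≡ + 0
S-δ-below zero    i = refl
S-δ-below (suc N) i = trans (+-identityˡ _)
  (trans (cong (S (+ 1) N δ) (lem (+ (N ℕ.+ i)))) (S-δ-below N i))
  where
  lem : ∀ k → - (+ 1 + k) + + 1 ≡ - k
  lem = solve-∀

S-δ-inside : ∀ N i → i ℕ.< N → S (+ 1) N δ (- + i) ≡ + 1
S-δ-inside (suc N) zero    _         = cong (_+_ (+ 1)) (S-δ-above N 0)
S-δ-inside (suc N) (suc i) (ℕ.s≤s p) = trans (+-identityˡ _)
  (trans (cong (S (+ 1) N δ) (lem (+ i))) (S-δ-inside N i p))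
  where
  lem : ∀ k → - (+ 1 + k) + + 1 ≡ - k
  lem = solve-∀

-- The type B Eulerian triangle, on all integers J so that its edges need no separate cases.
eulerianB : ℕ → ℤ → ℤ
eulerianB zero    J = δ J
eulerianB (suc n) J = (+ 2 * J + + 1) * eulerianB n J + (+ 2 * + n + + 3 - + 2 * J) * eulerianB n (J - + 1)

scale : ℕ → ℕ
scale n = 2 ℕ.^ n ℕ.* n !

-- For n = 2a and N = 2M + 1 this is -(n+1)M - (J - a)N, the argument at which the chain evaluates
-- the spline. The offset a is separate from n because the induction lowers n and keeps a.
point : ℕ → ℕ → ℕ → ℤ → ℤ
point N M a J = - (J * + N + + M - + a)

scaledSpline : ℕ → ℕ → ℤ → ℤ
scaledSpline N n t = + scale n * spline N (suc n) t

-- Doubling allows 2M = N - 1, and t + N is the point of J - 1. The coefficients of N are then those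
-- of `eulerianB`; the bounded remainders are opposite, so they multiply a difference of two spline
-- values.
scaledSpline-recurrence : ∀ N M a n J → N ≡ suc (M ℕ.+ M) → scaledSpline N (suc n) (point N M a J) ≡
  ((+ 2 * J + + 1) * + N + (+ 2 * + n + + 1 - + 2 * + a)) * scaledSpline N n (point N M a J)
  + ((+ 2 * + n + + 3 - + 2 * J) * + N - (+ 2 * + n + + 1 - + 2 * + a)) * scaledSpline N n (point N M a (J - + 1))
scaledSpline-recurrence N M a n J refl = begin
  + scale (suc n) * spline N (suc (suc n)) t
    ≡⟨ cong (_* spline N (suc (suc n)) t) scale-suc ⟩
  + 2 * + suc n * + scale n * spline N (suc (suc n)) t
    ≡⟨ l₁ (+ suc n) (+ scale n) _ ⟩
  + 2 * + scale n * (+ suc n * spline N (suc (suc n)) t)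
    ≡⟨ cong (+ 2 * + scale n *_) (spline-recurrence N (suc n) t) ⟩
  + 2 * + scale n * ((+ suc n - t) * spline N (suc n) t + ((+ 1 + + suc n) * + N + t - + suc n) * spline N (suc n) (t + + N))
    ≡⟨ cong (λ v → + 2 * + scale n * ((+ suc n - t) * spline N (suc n) t + ((+ 1 + + suc n) * + N + t - + suc n) * spline N (suc n) v))
         (l₂ J (+ N) (+ M) (+ a)) ⟩
  + 2 * + scale n * ((+ suc n - t) * spline N (suc n) t + ((+ 1 + + suc n) * + N + t - + suc n) * spline N (suc n) t′)
    ≡⟨ l₃ (+ scale n) (+ n) J (+ M) (+ a) (spline N (suc n) t) (spline N (suc n) t′) ⟩
  ((+ 2 * J + + 1) * + N + (+ 2 * + n + + 1 - + 2 * + a)) * scaledSpline N n t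
  + ((+ 2 * + n + + 3 - + 2 * J) * + N - (+ 2 * + n + + 1 - + 2 * + a)) * scaledSpline N n t′ ∎
  where
  t t′ : ℤ
  t  = point N M a J
  t′ = point N M a (J - + 1)
  scale-suc : + scale (suc n) ≡ + 2 * + suc n * + scale n
  scale-suc = trans (cong +_ (rearrange (2 ℕ.^ n) (n !) n))
    (trans (ℤₚ.pos-* (2 ℕ.* suc n) (scale n)) (cong (_* + scale n) (ℤₚ.pos-* 2 (suc n))))
    where
    rearrange : ∀ p f n → 2 ℕ.* p ℕ.* ((1 ℕ.+ n) ℕ.* f) ≡ 2 ℕ.* (1 ℕ.+ n) ℕ.* (p ℕ.* f)
    rearrange = ℕ-Ring.solve-∀
  l₁ : ∀ s c x → + 2 * s * c * x ≡ + 2 * c * (s * x)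
  l₁ = solve-∀
  l₂ : ∀ J N M a → - (J * N + M - a) + N ≡ - ((J - + 1) * N + M - a)
  l₂ = solve-∀
  l₃ : ∀ c n J M a x y → let N = + 1 + (M + M) ; t = - (J * N + M - a) in
    + 2 * c * (((+ 1 + n) - t) * x + ((+ 1 + (+ 1 + n)) * N + t - (+ 1 + n)) * y)
    ≡ ((+ 2 * J + + 1) * N + (+ 2 * n + + 1 - + 2 * a)) * (c * x)
      + ((+ 2 * n + + 3 - + 2 * J) * N - (+ 2 * n + + 1 - + 2 * a)) * (c * y)
  l₃ = solve-∀

-- A single window is the indicator of -N < t ≤ 0, and 0 ≤ M - a < N singles out J = 0.
scaledSpline-zero : ∀ N M a i J → N ≡ suc (M ℕ.+ M) → M ≡ a ℕ.+ i → scaledSpline N 0 (point N M a J) ≡ δ J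
scaledSpline-zero N M a i J refl refl = trans (ℤₚ.*-identityˡ _) (lem J)
  where
  lem : ∀ J → S (+ 1) N δ (point N M a J) ≡ δ J
  lem (+ zero) = trans (cong (S (+ 1) N δ) (eq (+ N) (+ a) (+ i)))
    (S-δ-inside N i (ℕ.s≤s (ℕₚ.≤-trans (ℕₚ.m≤n+m i a) (ℕₚ.m≤m+n M M))))
    where
    eq : ∀ N a i → - (+ 0 * N + (a + i) - a) ≡ - i
    eq = solve-∀
  lem (+ suc j) = trans (cong (S (+ 1) N δ) (trans (eq (+ j) (+ N) (+ a) (+ i))
      (cong (λ v → - (+ N + (v + + i))) (sym (ℤₚ.pos-* j N)))))
    (S-δ-below N (j ℕ.* N ℕ.+ i))
    where
    eq : ∀ j N a i → - ((+ 1 + j) * N + (a + i) - a) ≡ - (N + (j * N + i))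
    eq = solve-∀
  lem -[1+ j ] = trans (cong (S (+ 1) N δ) (trans (eq (+ j) (+ a) (+ i))
      (cong (λ v → + 1 + (v + (+ a + + i + + a))) (sym (ℤₚ.pos-* j N)))))
    (S-δ-above N (j ℕ.* N ℕ.+ (M ℕ.+ a)))
    where
    eq : ∀ j a i → let N = + 1 + ((a + i) + (a + i)) in
      - (- (+ 1 + j) * N + (a + i) - a) ≡ + 1 + (j * N + (a + i + a))
    eq = solve-∀

abs-+-≤ : ∀ x y {A B} → ℤ.∣ x ∣ ℕ.≤ A → ℤ.∣ y ∣ ℕ.≤ B → ℤ.∣ x + y ∣ ℕ.≤ A ℕ.+ B
abs-+-≤ x y p q = ℕₚ.≤-trans (ℤₚ.∣i+j∣≤∣i∣+∣j∣ x y) (ℕₚ.+-mono-≤ p q)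

abs-*-≤ : ∀ c x {A} → ℤ.∣ x ∣ ℕ.≤ A → ℤ.∣ c * x ∣ ℕ.≤ ℤ.∣ c ∣ ℕ.* A
abs-*-≤ c x {A} p = subst (ℕ._≤ ℤ.∣ c ∣ ℕ.* A) (sym (ℤₚ.abs-* c x)) (ℕₚ.*-monoʳ-≤ ℤ.∣ c ∣ p)

-- A relative error of order 1/N; the factor N on the left avoids the exponent n - 1. The constant
-- is fixed before N and depends on n, a and J only.
scaledSpline-asymptotics : ∀ n a J → ∃[ C ] (∀ N M i → N ≡ suc (M ℕ.+ M) → M ≡ a ℕ.+ i →
  ℤ.∣ + N * (scaledSpline N n (point N M a J) - eulerianB n J * + (N ℕ.^ n)) ∣ ℕ.≤ C ℕ.* N ℕ.^ n)
scaledSpline-asymptotics zero a J = 0 , λ N M i N≡ M≡ → ℕₚ.≤-reflexive (cong ℤ.∣_∣ (begin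
  + N * (scaledSpline N 0 (point N M a J) - δ J * + 1)
    ≡⟨ cong (λ v → + N * (v - δ J * + 1)) (scaledSpline-zero N M a i J N≡ M≡) ⟩
  + N * (δ J - δ J * + 1)
    ≡⟨ lem (+ N) (δ J) ⟩
  + 0 ∎))
  where
  lem : ∀ N d → N * (d - d * + 1) ≡ + 0
  lem = solve-∀
scaledSpline-asymptotics (suc n) a J = C , bound
  where
  C₁ C₂ C : ℕ
  C₁ = proj₁ (scaledSpline-asymptotics n a J)
  C₂ = proj₁ (scaledSpline-asymptotics n a (J - + 1))
  α β e : ℤ
  α = + 2 * J + + 1
  β = + 2 * + n + + 3 - + 2 * J
  e = + 2 * + n + + 1 - + 2 * + a
  E₁ E₂ : ℤ
  E₁ = eulerianB n J
  E₂ = eulerianB n (J - + 1)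
  -- Follows `expand`: α and β pass on the errors of the induction hypotheses, while e meets d₁ and
  -- d₂ at full size, bounded by `main-term`.
  C = ℤ.∣ α ∣ ℕ.* C₁ ℕ.+ ℤ.∣ β ∣ ℕ.* C₂ ℕ.+ ℤ.∣ e ∣ ℕ.* ((ℤ.∣ E₁ ∣ ℕ.+ C₁) ℕ.+ (ℤ.∣ E₂ ∣ ℕ.+ C₂))
  expand : ∀ α β e N P d₁ d₂ E₁ E₂ →
    N * (((α * N + e) * d₁ + (β * N - e) * d₂) - (α * E₁ + β * E₂) * (N * P))
    ≡ (α * (N * (N * (d₁ - E₁ * P))) + β * (N * (N * (d₂ - E₂ * P)))) + e * (N * d₁ + - (N * d₂))
  expand = solve-∀
  regroup : ∀ α β e N P x₁ x₂ C₁ C₂ →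
    (α ℕ.* (N ℕ.* (C₁ ℕ.* P)) ℕ.+ β ℕ.* (N ℕ.* (C₂ ℕ.* P)))
      ℕ.+ e ℕ.* ((x₁ ℕ.+ C₁) ℕ.* (N ℕ.* P) ℕ.+ (x₂ ℕ.+ C₂) ℕ.* (N ℕ.* P))
    ≡ (α ℕ.* C₁ ℕ.+ β ℕ.* C₂ ℕ.+ e ℕ.* ((x₁ ℕ.+ C₁) ℕ.+ (x₂ ℕ.+ C₂))) ℕ.* (N ℕ.* P)
  regroup = ℕ-Ring.solve-∀
  main-term : ∀ M P d x C → let N = suc (M ℕ.+ M) in
    ℤ.∣ + N * (d - x * + P) ∣ ℕ.≤ C ℕ.* P → ℤ.∣ + N * d ∣ ℕ.≤ (ℤ.∣ x ∣ ℕ.+ C) ℕ.* (N ℕ.* P)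
  main-term M P d x C p = subst₂ ℕ._≤_ (cong ℤ.∣_∣ eq) (sym (ℕₚ.*-distribʳ-+ (N ℕ.* P) ℤ.∣ x ∣ C))
    (abs-+-≤ (x * + (N ℕ.* P)) (+ N * (d - x * + P)) (abs-*-≤ x (+ (N ℕ.* P)) ℕₚ.≤-refl)
             (ℕₚ.≤-trans p (ℕₚ.*-monoʳ-≤ C (ℕₚ.m≤m+n P ((M ℕ.+ M) ℕ.* P)))))
    where
    N : ℕ
    N = suc (M ℕ.+ M)
    lem : ∀ N P d x → x * (N * P) + N * (d - x * P) ≡ N * d
    lem = solve-∀
    eq : x * + (N ℕ.* P) + + N * (d - x * + P) ≡ + N * d
    eq = trans (cong (λ v → x * v + + N * (d - x * + P)) (ℤₚ.pos-* N P)) (lem (+ N) (+ P) d x)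
  bound : ∀ N M i → N ≡ suc (M ℕ.+ M) → M ≡ a ℕ.+ i →
    ℤ.∣ + N * (scaledSpline N (suc n) (point N M a J) - eulerianB (suc n) J * + (N ℕ.^ suc n)) ∣ ℕ.≤ C ℕ.* N ℕ.^ suc n
  bound N M i refl M≡ = subst₂ ℕ._≤_ (cong ℤ.∣_∣ (sym eq))
    (regroup (ℤ.∣ α ∣) (ℤ.∣ β ∣) (ℤ.∣ e ∣) N P (ℤ.∣ E₁ ∣) (ℤ.∣ E₂ ∣) C₁ C₂)
    (abs-+-≤ (α * (+ N * Δ₁) + β * (+ N * Δ₂)) (e * (+ N * d₁ + - (+ N * d₂)))
      (abs-+-≤ (α * (+ N * Δ₁)) (β * (+ N * Δ₂))
        (abs-*-≤ α (+ N * Δ₁) (abs-*-≤ (+ N) Δ₁ ih₁))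
        (abs-*-≤ β (+ N * Δ₂) (abs-*-≤ (+ N) Δ₂ ih₂)))
      (abs-*-≤ e (+ N * d₁ + - (+ N * d₂)) (abs-+-≤ (+ N * d₁) (- (+ N * d₂))
        (main-term M P d₁ E₁ C₁ ih₁)
        (subst (ℕ._≤ (ℤ.∣ E₂ ∣ ℕ.+ C₂) ℕ.* (N ℕ.* P)) (sym (ℤₚ.∣-i∣≡∣i∣ (+ N * d₂)))
          (main-term M P d₂ E₂ C₂ ih₂)))))
    where
    P : ℕ
    P = N ℕ.^ n
    d₁ d₂ Δ₁ Δ₂ : ℤ
    d₁ = scaledSpline N n (point N M a J)
    d₂ = scaledSpline N n (point N M a (J - + 1))
    Δ₁ = + N * (d₁ - E₁ * + P)
    Δ₂ = + N * (d₂ - E₂ * + P)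
    ih₁ = proj₂ (scaledSpline-asymptotics n a J) N M i refl M≡
    ih₂ = proj₂ (scaledSpline-asymptotics n a (J - + 1)) N M i refl M≡
    eq : + N * (scaledSpline N (suc n) (point N M a J) - eulerianB (suc n) J * + (N ℕ.^ suc n)) ≡
      (α * (+ N * Δ₁) + β * (+ N * Δ₂))
        + e * (+ N * d₁ + - (+ N * d₂))
    eq = trans (cong₂ (λ v w → + N * (v - eulerianB (suc n) J * w)) (scaledSpline-recurrence N M a n J refl) (ℤₚ.pos-* N P))
      (expand α β e (+ N) (+ P) d₁ d₂ E₁ E₂)

-- Composition of carries

δ-scale : ∀ N k → δ (k * + suc N) ≡ δ k
δ-scale N (+ zero)  = refl
δ-scale N (+ suc k) = refl
δ-scale N -[1+ k ]  = refl

-- Steps of length N starting at a multiple of N stay on multiples of N, so dividing by N gives unit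
-- steps.
It-grid : ∀ N b m k → It (+ suc N) b m δ (k * + suc N) ≡ spline b m k
It-grid N b zero    k = δ-scale N k
It-grid N b (suc m) k = S-grid b k
  where
  S-grid : ∀ b′ k → S (+ suc N) b′ (It (+ suc N) b m δ) (k * + suc N) ≡ S (+ 1) b′ (spline b m) k
  S-grid zero     k = refl
  S-grid (suc b′) k = cong₂ _+_ (It-grid N b m k)
    (trans (cong (S (+ suc N) b′ (It (+ suc N) b m δ)) (lem k (+ suc N))) (S-grid b′ (k + + 1)))
    where
    lem : ∀ k n → k * n + n ≡ (k + + 1) * n
    lem = solve-∀

OffGrid : ℕ → ℤ → Set
OffGrid N u = ∀ k → ¬ (u ≡ k * + N)

OffGrid-+ : ∀ N u q → OffGrid N u → OffGrid N (u + q * + N)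
OffGrid-+ N u q off k eq = off (k - q) (trans (l₁ u (q * + N)) (trans (cong (_- q * + N) eq) (l₂ k q (+ N))))
  where
  l₁ : ∀ u v → u ≡ u + v - v
  l₁ = solve-∀
  l₂ : ∀ k q n → k * n - q * n ≡ (k - q) * n
  l₂ = solve-∀

-- Steps of length N never leave the residue class of u, so they never reach 0.
It-offgrid : ∀ N b m u → OffGrid N u → It (+ N) b m δ u ≡ + 0
It-offgrid N b zero    u off = δ-≢0 u (λ u≡0 → off (+ 0) (trans u≡0 (sym (*-zeroˡ (+ N)))))
It-offgrid N b (suc m) u off = S-offgrid b u off
  where
  S-offgrid : ∀ b′ u → OffGrid N u → S (+ N) b′ (It (+ N) b m δ) u ≡ + 0
  S-offgrid zero     u off = refl
  S-offgrid (suc b′) u off = cong₂ _+_ (It-offgrid N b m u off)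
    (S-offgrid b′ (u + + N)
      (subst (OffGrid N) (cong (_+_ u) (ℤₚ.*-identityˡ (+ N))) (OffGrid-+ N u (+ 1) off)))

S-local : ∀ N f g t → (∀ x → x ℕ.< N → f (t + + x) ≡ g (t + + x)) → S (+ 1) N f t ≡ S (+ 1) N g t
S-local zero    f g t p = refl
S-local (suc N) f g t p = cong₂ _+_
  (subst (λ v → f v ≡ g v) (+-identityʳ t) (p 0 (ℕ.s≤s ℕ.z≤n)))
  (S-local N f g (t + + 1)
    (λ x x<N → subst (λ v → f v ≡ g v) (sym (+-assoc t (+ 1) (+ x))) (p (suc x) (ℕ.s≤s x<N))))

-- m windows of K + 1 points starting at t reach no further than t + mK. This lets the high digits
-- be replaced by a function that agrees with them only on attainable low-digit sums.
It-local : ∀ K m f g t → (∀ i → i ℕ.≤ m ℕ.* K → f (t + + i) ≡ g (t + + i)) →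
  It (+ 1) (suc K) m f t ≡ It (+ 1) (suc K) m g t
It-local K zero    f g t p = subst (λ v → f v ≡ g v) (+-identityʳ t) (p 0 ℕ.z≤n)
It-local K (suc m) f g t p = S-local (suc K) (It (+ 1) (suc K) m f) (It (+ 1) (suc K) m g) t λ { x (ℕ.s≤s x≤K) →
  It-local K m f g (t + + x) λ i i≤ →
    subst (λ v → f v ≡ g v) (sym (+-assoc t (+ x) (+ i))) (p (x ℕ.+ i) (ℕₚ.+-mono-≤ x≤K i≤)) }

S-pick-none : ∀ len a i (g : ℤ → ℤ) → S (+ 1) len (λ k → g k * δ (a - k)) (a + + suc i) ≡ + 0
S-pick-none zero      a i g = refl
S-pick-none (suc len) a i g = cong₂ _+_
  (trans (cong (λ v → g (a + + suc i) * δ v) (lem a (+ suc i))) (*-zeroʳ (g (a + + suc i))))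
  (trans (cong (S (+ 1) len (λ k → g k * δ (a - k)))
      (trans (+-assoc a (+ suc i) (+ 1)) (cong (λ v → a + + v) (ℕₚ.+-comm (suc i) 1))))
    (S-pick-none len a (suc i) g))
  where
  lem : ∀ a s → a - (a + s) ≡ - s
  lem = solve-∀

S-pick : ∀ len a i (g : ℤ → ℤ) → i ℕ.< len →
  S (+ 1) len (λ k → g k * δ (a + + i - k)) a ≡ g (a + + i)
S-pick (suc len) a zero g _ rewrite +-identityʳ a = begin
  g a * δ (a - a) + S (+ 1) len (λ k → g k * δ (a - k)) (a + + 1)
    ≡⟨ cong₂ (λ v w → g a * δ v + w) (ℤₚ.+-inverseʳ a) (S-pick-none len a 0 g) ⟩
  g a * + 1 + + 0
    ≡⟨ trans (+-identityʳ _) (ℤₚ.*-identityʳ (g a)) ⟩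
  g a ∎
S-pick (suc len) a (suc i) g (ℕ.s≤s i<len) = begin
  g a * δ (a + + suc i - a) + S (+ 1) len (λ k → g k * δ (a + + suc i - k)) (a + + 1)
    ≡⟨ cong₂ _+_ (trans (cong (λ v → g a * δ v) (lem a (+ suc i))) (*-zeroʳ (g a)))
         (cong (λ q → S (+ 1) len (λ k → g k * δ (q - k)) (a + + 1)) (sym (+-assoc a (+ 1) (+ i)))) ⟩
  + 0 + S (+ 1) len (λ k → g k * δ (a + + 1 + + i - k)) (a + + 1)
    ≡⟨ trans (+-identityˡ _) (S-pick len (a + + 1) i g i<len) ⟩
  g (a + + 1 + + i)
    ≡⟨ cong g (+-assoc a (+ 1) (+ i)) ⟩
  g (a + + suc i) ∎
  where
  lem : ∀ a s → a + s - a ≡ s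
  lem = solve-∀

∣i-k∣≤k : ∀ i k → i ℕ.≤ k ℕ.+ k → ℤ.∣ - + k + + i ∣ ℕ.≤ k
∣i-k∣≤k i k i≤2k rewrite ℤₚ.-m+n≡n⊖m k i with ℕₚ.≤-total i k
... | inj₁ i≤k rewrite ℤₚ.∣⊖∣-≤ i≤k = ℕₚ.m∸n≤m k i
... | inj₂ k≤i rewrite ℤₚ.∣m⊖n∣≡∣n⊖m∣ i k | ℤₚ.∣⊖∣-≤ k≤i =
  ℕₚ.≤-trans (ℕₚ.∸-monoˡ-≤ k i≤2k) (ℕₚ.≤-reflexive (ℕₚ.m+n∸n≡m k k))

-- Otherwise qN ≥ (h+1)(2M+1) = (2h+1)M + M + h + 1. With n = 2h, this bounds the carry q when n + 1
-- balanced base-N digits sum to qN.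
quotient-bound : ∀ h M q → q ℕ.* suc (M ℕ.+ M) ℕ.≤ suc (h ℕ.+ h) ℕ.* M → q ℕ.≤ h
quotient-bound h M q p with q ℕ.≤? h
... | yes q≤h = q≤h
... | no  q≰h = contradiction
  (ℕₚ.≤-trans (ℕₚ.*-monoˡ-≤ (suc (M ℕ.+ M)) (ℕₚ.≰⇒> q≰h)) p)
  (ℕₚ.<⇒≱ (ℕₚ.≤-trans (ℕₚ.m≤m+n _ (M ℕ.+ h)) (ℕₚ.≤-reflexive (lem h M))))
  where
  lem : ∀ h M → 1 ℕ.+ ((1 ℕ.+ (h ℕ.+ h)) ℕ.* M) ℕ.+ (M ℕ.+ h) ≡ (1 ℕ.+ h) ℕ.* (1 ℕ.+ (M ℕ.+ M))
  lem = ℕ-Ring.solve-∀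

∣q∣≤h⇒offset : ∀ q h → ℤ.∣ q ∣ ℕ.≤ h → ∃ λ i → (i ℕ.< suc (h ℕ.+ h)) × (q ≡ - + h + + i)
∣q∣≤h⇒offset (+ q)    h q≤h = h ℕ.+ q , ℕ.s≤s (ℕₚ.+-monoʳ-≤ h q≤h) , lem (+ h) (+ q)
  where
  lem : ∀ h q → q ≡ - h + (h + q)
  lem = solve-∀
∣q∣≤h⇒offset -[1+ q ] h q<h = h ℕ.∸ suc q ,
  ℕ.s≤s (ℕₚ.≤-trans (ℕₚ.m∸n≤m h (suc q)) (ℕₚ.m≤m+n h h)) ,
  trans (lem (+ h) (+ suc q)) (cong (_+_ (- + h))
    (trans (ℤₚ.m-n≡m⊖n h (suc q)) (ℤₚ.⊖-≥ q<h)))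
  where
  lem : ∀ h q → - q ≡ - h + (h - q)
  lem = solve-∀

-- Carries propagate: base bN = base N followed by base b.  The carry out of
-- the N-block never leaves the state space because 2|k| ≤ n.
spline-compose : ∀ h M c b N j → N ≡ suc (M ℕ.+ M) → b ≡ suc (c ℕ.+ c) → let n = h ℕ.+ h ; m = + suc n in
  ∑ (range (- + h) (suc n)) (λ k → spline N (suc n) (- (m * + M) - k * + N) * spline b (suc n) (k - m * + c - j * + b))
  ≡ spline (b ℕ.* N) (suc n) (- (m * (+ M + + N * + c)) - j * + (b ℕ.* N))
spline-compose h M c b N j refl refl = sym (begin
  spline (b ℕ.* N) (suc n) (- (m * (+ M + ν * + c)) - j * + (b ℕ.* N))
    ≡⟨ It-split b N (suc n) δ _ ⟩
  It (+ 1) N (suc n) G (- (m * (+ M + ν * + c)) - j * + (b ℕ.* N))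
    ≡⟨ cong (It (+ 1) N (suc n) G) (trans
         (cong (λ w → - (m * (+ M + ν * + c)) - j * w) (ℤₚ.pos-* b N))
         (l₁ m (+ M) ν (+ c) j (+ b))) ⟩
  It (+ 1) N (suc n) G (t + v * ν)
    ≡⟨ sym (It-shift (+ 1) N (suc n) G (v * ν) t) ⟩
  It (+ 1) N (suc n) (λ w → G (w + v * ν)) t
    -- For attainable w, that is |w| ≤ (n+1)M, the high-digit count G vanishes unless w = qN, and
    -- then |q| ≤ h. So G may be replaced by point masses at kN, with k over the states only.
    ≡⟨ It-local (M ℕ.+ M) (suc n) _ _ t local ⟩
  It (+ 1) N (suc n) (λ w → ∑ ks (λ k → g k * δ (w + - (k * ν)))) t
    ≡⟨ It-∑ (+ 1) N (suc n) ks (λ k w → g k * δ (w + - (k * ν))) t ⟩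
  ∑ ks (λ k → It (+ 1) N (suc n) (λ w → g k * δ (w + - (k * ν))) t)
    ≡⟨ ∑-cong ks (λ k → begin
         It (+ 1) N (suc n) (λ w → g k * δ (w + - (k * ν))) t
           ≡⟨ It-*ˡ (+ 1) N (suc n) (g k) _ t ⟩
         g k * It (+ 1) N (suc n) (λ w → δ (w + - (k * ν))) t
           ≡⟨ cong (g k *_) (It-shift (+ 1) N (suc n) δ (- (k * ν)) t) ⟩
         g k * spline N (suc n) (t + - (k * ν))
           ≡⟨ ℤₚ.*-comm (g k) _ ⟩
         spline N (suc n) (t + - (k * ν)) * g k ∎) ⟩
  ∑ ks (λ k → spline N (suc n) (t - k * ν) * g k) ∎)
  where
  n : ℕ
  n = h ℕ.+ h
  m ν v t : ℤ
  m = + suc n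
  ν = + N
  v = - (m * + c) - j * + b
  t = - (m * + M)
  ks = range (- + h) (suc n)
  g G : ℤ → ℤ
  g k = spline b (suc n) (k - m * + c - j * + b)
  G = It ν b (suc n) δ
  l₁ : ∀ m M ν c j b → - (m * (M + ν * c)) - j * (b * ν) ≡ - (m * M) + (- (m * c) - j * b) * ν
  l₁ = solve-∀
  l₂ : ∀ q m c j b ν → q * ν + (- (m * c) - j * b) * ν ≡ (q - m * c - j * b) * ν
  l₂ = solve-∀
  l₃ : ∀ q k ν → q * ν + - (k * ν) ≡ (q - k) * ν
  l₃ = solve-∀
  on-grid : ∀ q → ℤ.∣ q * ν ∣ ℕ.≤ suc n ℕ.* M →
    G (q * ν + v * ν) ≡ ∑ ks (λ k → g k * δ (q * ν + - (k * ν)))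
  on-grid q bnd with ∣q∣≤h⇒offset q h (quotient-bound h M ℤ.∣ q ∣ (subst (ℕ._≤ suc n ℕ.* M) (ℤₚ.abs-* q ν) bnd))
  ... | i , i<len , q≡ = begin
    G (q * ν + v * ν)
      ≡⟨ cong G (l₂ q m (+ c) j (+ b) ν) ⟩
    G ((q - m * + c - j * + b) * ν)
      ≡⟨ It-grid (M ℕ.+ M) b (suc n) (q - m * + c - j * + b) ⟩
    g q
      ≡⟨ cong g q≡ ⟩
    g (- + h + + i)
      ≡⟨ sym (S-pick (suc n) (- + h) i g i<len) ⟩
    S (+ 1) (suc n) (λ k → g k * δ (- + h + + i - k)) (- + h)
      ≡⟨ sym (∑-range (suc n) (- + h) (λ k → g k * δ (- + h + + i - k))) ⟩
    ∑ ks (λ k → g k * δ (- + h + + i - k))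
      ≡⟨ ∑-cong ks (λ k → cong (g k *_) (begin
           δ (- + h + + i - k)          ≡⟨ cong (λ x → δ (x - k)) (sym q≡) ⟩
           δ (q - k)                    ≡⟨ sym (δ-scale (M ℕ.+ M) (q - k)) ⟩
           δ ((q - k) * ν)              ≡⟨ cong δ (sym (l₃ q k ν)) ⟩
           δ (q * ν + - (k * ν))        ∎)) ⟩
    ∑ ks (λ k → g k * δ (q * ν + - (k * ν))) ∎
  off-grid : ∀ w → OffGrid N w → G (w + v * ν) ≡ ∑ ks (λ k → g k * δ (w + - (k * ν)))
  off-grid w off = trans (It-offgrid N b (suc n) _ (OffGrid-+ N w v off))
    (sym (trans (∑-cong ks (λ k → trans
        (cong (g k *_) (δ-≢0 _ (λ e → off k (ℤₚ.i-j≡0⇒i≡j w (k * ν) e))))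
        (*-zeroʳ (g k))))
      (∑-zero ks)))
  remainder-off : ∀ r q → suc r ℕ.< N → OffGrid N (+ suc r + q * ν)
  remainder-off r q r<N k eq = no-small (k - q) (trans (l₄ (+ suc r) (q * ν)) (trans (cong (_- q * ν) eq) (l₅ k q ν)))
    where
    l₄ : ∀ u v → u ≡ u + v - v
    l₄ = solve-∀
    l₅ : ∀ k q n → k * n - q * n ≡ (k - q) * n
    l₅ = solve-∀
    no-small : ∀ d → ¬ (+ suc r ≡ d * ν)
    no-small (+ suc d) e = ℕₚ.<⇒≱ r<N (ℕₚ.≤-trans (ℕₚ.m≤m+n N (d ℕ.* N))
      (ℕₚ.≤-reflexive (sym (ℤₚ.+-injective e))))
  local-w : ∀ w → ℤ.∣ w ∣ ℕ.≤ suc n ℕ.* M → G (w + v * ν) ≡ ∑ ks (λ k → g k * δ (w + - (k * ν)))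
  local-w w bnd with w %ℕ N | w /ℕ N | a≡a%ℕn+[a/ℕn]*n w N | n%ℕd<d w N
  ... | zero  | q | e | _ = subst (λ w → G (w + v * ν) ≡ ∑ ks (λ k → g k * δ (w + - (k * ν)))) (sym e′)
          (on-grid q (subst (λ w → ℤ.∣ w ∣ ℕ.≤ suc n ℕ.* M) e′ bnd))
    where
    e′ : w ≡ q * ν
    e′ = trans e (+-identityˡ _)
  ... | suc r | q | e | r<N = off-grid w (subst (OffGrid N) (sym e) (remainder-off r q r<N))
  local : ∀ i → i ℕ.≤ suc n ℕ.* (M ℕ.+ M) →
    G (t + + i + v * ν) ≡ ∑ ks (λ k → g k * δ (t + + i + - (k * ν)))
  local i i≤ = local-w (t + + i) (subst (λ x → ℤ.∣ - x + + i ∣ ℕ.≤ suc n ℕ.* M) (ℤₚ.pos-* (suc n) M)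
    (∣i-k∣≤k i (suc n ℕ.* M) (ℕₚ.≤-trans i≤ (ℕₚ.≤-reflexive (ℕₚ.*-distribˡ-+ (suc n) M M)))))

-- The carries chain

x≤ᵇx+k : ∀ x k → (x ≤ᵇ (x + + k)) ≡ true
x≤ᵇx+k x k = dec-true (x ℤ.≤? (x + + k)) (ℤₚ.i≤i+j x (+ k))

x+k≰ᵇx : ∀ x k → ((x + + suc k) ≤ᵇ x) ≡ false
x+k≰ᵇx x k = dec-false ((x + + suc k) ℤ.≤? x)
  (λ p → absurd (subst (ℤ._≤_ (+ 0)) (lem x (+ suc k)) (ℤₚ.i≤j⇒0≤j-i p)))
  where
  lem : ∀ x s → x - (x + s) ≡ - s
  lem = solve-∀
  absurd : ¬ (+ 0 ℤ.≤ - + suc k)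
  absurd ()

-- Since b = 2c + 1, the condition -c ≤ s - jb ≤ c reads -b < w ≤ 0. The cases are w = 0, w above
-- the window, and w negative inside or below it.
interval-indicator : ∀ c j b s w → b ≡ suc (c ℕ.+ c) → s ≡ w + + c + j * + b →
  ⟦ ((j * + b) - + c) ≤ᵇ s ∧ s ≤ᵇ ((j * + b) + + c) ⟧ ≡ S (+ 1) b δ w
interval-indicator c j b s (+ zero) refl refl = begin
  ⟦ (x - + c) ≤ᵇ s ∧ s ≤ᵇ (x + + c) ⟧
    ≡⟨ cong₂ (λ u v → ⟦ u ∧ v ⟧)
         (trans (cong ((x - + c) ≤ᵇ_) (l₁ x (+ c))) (x≤ᵇx+k (x - + c) (c ℕ.+ c)))
         (trans (cong (s ≤ᵇ_) (l₂ x (+ c))) (x≤ᵇx+k s 0)) ⟩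
  + 1
    ≡⟨ sym (S-δ-inside b 0 (ℕ.s≤s ℕ.z≤n)) ⟩
  S (+ 1) b δ (+ 0) ∎
  where
  x : ℤ
  x = j * + b
  l₁ : ∀ x c → + 0 + c + x ≡ (x - c) + (c + c)
  l₁ = solve-∀
  l₂ : ∀ x c → x + c ≡ + 0 + c + x + + 0
  l₂ = solve-∀
interval-indicator c j b s (+ suc i) refl refl = begin
  ⟦ (x - + c) ≤ᵇ s ∧ s ≤ᵇ (x + + c) ⟧
    ≡⟨ cong (λ u → ⟦ (x - + c) ≤ᵇ s ∧ u ⟧)
         (trans (cong (_≤ᵇ (x + + c)) (l₁ x (+ c) (+ suc i))) (x+k≰ᵇx (x + + c) i)) ⟩
  ⟦ (x - + c) ≤ᵇ s ∧ false ⟧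
    ≡⟨ trans (⟦⟧-∧ ((x - + c) ≤ᵇ s) false) (*-zeroʳ ⟦ (x - + c) ≤ᵇ s ⟧) ⟩
  + 0
    ≡⟨ sym (S-δ-above b i) ⟩
  S (+ 1) b δ (+ suc i) ∎
  where
  x : ℤ
  x = j * + b
  l₁ : ∀ x c i → i + c + x ≡ x + c + i
  l₁ = solve-∀
interval-indicator c j b s -[1+ i ] refl refl with suc i ℕ.<? b
... | yes i<b = begin
  ⟦ (x - + c) ≤ᵇ s ∧ s ≤ᵇ (x + + c) ⟧
    ≡⟨ cong₂ (λ u v → ⟦ u ∧ v ⟧)
         (trans (cong ((x - + c) ≤ᵇ_) (trans (l₁ x (+ c) (+ suc i))
             (cong (_+_ (x - + c)) (trans (ℤₚ.m-n≡m⊖n (c ℕ.+ c) (suc i)) (ℤₚ.⊖-≥ (ℕ.s≤s⁻¹ i<b))))))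
           (x≤ᵇx+k (x - + c) (c ℕ.+ c ℕ.∸ suc i)))
         (trans (cong (s ≤ᵇ_) (l₂ x (+ c) (+ suc i))) (x≤ᵇx+k s (suc i))) ⟩
  + 1
    ≡⟨ sym (S-δ-inside b (suc i) i<b) ⟩
  S (+ 1) b δ -[1+ i ] ∎
  where
  x : ℤ
  x = j * + b
  l₁ : ∀ x c i → - i + c + x ≡ (x - c) + (c + c - i)
  l₁ = solve-∀
  l₂ : ∀ x c i → x + c ≡ - i + c + x + i
  l₂ = solve-∀
... | no i≮b = begin
  ⟦ (x - + c) ≤ᵇ s ∧ s ≤ᵇ (x + + c) ⟧
    ≡⟨ cong (λ u → ⟦ u ∧ s ≤ᵇ (x + + c) ⟧)
         (trans (cong (_≤ᵇ s) (trans (l₁ x (+ c) (+ k)) (cong (λ v → - + v + + c + x + + suc k) (sym i≡))))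
           (x+k≰ᵇx s k)) ⟩
  + 0
    ≡⟨ sym (S-δ-below b k) ⟩
  S (+ 1) b δ (- + (b ℕ.+ k))
    ≡⟨ cong (λ v → S (+ 1) b δ (- + v)) (sym i≡) ⟩
  S (+ 1) b δ -[1+ i ] ∎
  where
  x : ℤ
  x = j * + b
  k : ℕ
  k = suc i ℕ.∸ b
  i≡ : suc i ≡ b ℕ.+ k
  i≡ = sym (ℕₚ.m+[n∸m]≡n (ℕₚ.≮⇒≥ i≮b))
  l₁ : ∀ x c k → x - c ≡ - (+ 1 + (c + c) + k) + c + x + (+ 1 + k)
  l₁ = solve-∀

-- The window condition is one more window sum of `δ`, which raises the order from n to n + 1. The n
-- digits and the window each shift the argument by -c.
count≡spline : ∀ b c n i j → b ≡ suc (c ℕ.+ c) →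
  + count (λ X → ((j * + b) - + c) ≤ᵇ (i + sumℤ X) ∧ (i + sumℤ X) ≤ᵇ ((j * + b) + + c))
          (tuples n (range (- + c) b))
  ≡ spline b (suc n) (i - + suc n * + c - j * + b)
count≡spline b c n i j b≡ = begin
  + count _ (tuples n (range (- + c) b))
    ≡⟨ +count≡∑ _ (tuples n (range (- + c) b)) ⟩
  ∑ (tuples n (range (- + c) b)) (λ X → ind (i + sumℤ X))
    ≡⟨ ∑-tuples-range n (- + c) b ind i ⟩
  It (+ 1) b n ind t
    ≡⟨ It-cong (+ 1) b n (λ s → interval-indicator c j b s (s + - (+ c + j * + b)) b≡ (l₁ s (+ c) (j * + b))) t ⟩
  It (+ 1) b n (λ s → S (+ 1) b δ (s + - (+ c + j * + b))) t
    ≡⟨ It-shift (+ 1) b n (S (+ 1) b δ) (- (+ c + j * + b)) t ⟩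
  It (+ 1) b n (S (+ 1) b δ) (t + - (+ c + j * + b))
    ≡⟨ It-S-comm (+ 1) b n (+ 1) b δ _ ⟩
  spline b (suc n) (t + - (+ c + j * + b))
    ≡⟨ cong (spline b (suc n)) (l₂ i (+ n) (+ c) (j * + b)) ⟩
  spline b (suc n) (i - + suc n * + c - j * + b) ∎
  where
  ind : ℤ → ℤ
  ind s = ⟦ ((j * + b) - + c) ≤ᵇ s ∧ s ≤ᵇ ((j * + b) + + c) ⟧
  t : ℤ
  t = i + + n * - + c
  l₁ : ∀ s c x → s ≡ s + - (c + x) + c + x
  l₁ = solve-∀
  l₂ : ∀ i n c x → i + n * - c + - (c + x) ≡ i - (+ 1 + n) * c - x
  l₂ = solve-∀

-- Fractions over natural denominators and powers of the chain

fromℚᵘ-* : ∀ x y → ℚ.fromℚᵘ x ℚ.* ℚ.fromℚᵘ y ≡ ℚ.fromℚᵘ (x ℚᵘ.* y)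
fromℚᵘ-* x y = ℚₚ.toℚᵘ-injective (ℚᵘₚ.≃-trans (ℚₚ.toℚᵘ-homo-* (ℚ.fromℚᵘ x) (ℚ.fromℚᵘ y))
  (ℚᵘₚ.≃-trans (ℚᵘₚ.*-cong (ℚₚ.toℚᵘ-fromℚᵘ x) (ℚₚ.toℚᵘ-fromℚᵘ y)) (ℚᵘₚ.≃-sym (ℚₚ.toℚᵘ-fromℚᵘ (x ℚᵘ.* y)))))

fromℚᵘ-+ : ∀ x y → ℚ.fromℚᵘ x ℚ.+ ℚ.fromℚᵘ y ≡ ℚ.fromℚᵘ (x ℚᵘ.+ y)
fromℚᵘ-+ x y = ℚₚ.toℚᵘ-injective (ℚᵘₚ.≃-trans (ℚₚ.toℚᵘ-homo-+ (ℚ.fromℚᵘ x) (ℚ.fromℚᵘ y))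
  (ℚᵘₚ.≃-trans (ℚᵘₚ.+-cong (ℚₚ.toℚᵘ-fromℚᵘ x) (ℚₚ.toℚᵘ-fromℚᵘ y)) (ℚᵘₚ.≃-sym (ℚₚ.toℚᵘ-fromℚᵘ (x ℚᵘ.+ y)))))

÷ℕ-* : ∀ p q d e .{{_ : ℕ.NonZero d}} .{{_ : ℕ.NonZero e}} →
  (p ÷ℕ d) ℚ.* (q ÷ℕ e) ≡ (p * q) ÷ℕ (d ℕ.* e)
÷ℕ-* p q (suc d) (suc e) = fromℚᵘ-* (mkℚᵘ p d) (mkℚᵘ q e)

÷ℕ-+ : ∀ p q d → (p ÷ℕ d) ℚ.+ (q ÷ℕ d) ≡ (p + q) ÷ℕ d
÷ℕ-+ p q zero    = refl
÷ℕ-+ p q (suc d) = trans (fromℚᵘ-+ (mkℚᵘ p d) (mkℚᵘ q d))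
  (ℚₚ.fromℚᵘ-cong {mkℚᵘ p d ℚᵘ.+ mkℚᵘ q d} {mkℚᵘ (p + q) d} (*≡* (trans (lem p q (+ suc d)) (cong ((p + q) *_) (sym (ℤₚ.pos-* (suc d) (suc d)))))))
  where
  lem : ∀ p q d → (p * d + q * d) * d ≡ (p + q) * (d * d)
  lem = solve-∀

0÷ℕ : ∀ d → (+ 0) ÷ℕ d ≡ 0ℚ
0÷ℕ zero    = refl
0÷ℕ (suc d) = ℚₚ.0/n≡0 (suc d)

sumℚ-÷ℕ : (xs : List A) (f : A → ℤ) (d : ℕ) → sumℚ (map (λ x → f x ÷ℕ d) xs) ≡ ∑ xs f ÷ℕ d
sumℚ-÷ℕ []       f d = sym (0÷ℕ d)
sumℚ-÷ℕ (x ∷ xs) f d = trans (cong (ℚ._+_ (f x ÷ℕ d)) (sumℚ-÷ℕ xs f d)) (÷ℕ-+ (f x) (∑ xs f) d)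

sumℚ-cong : (xs : List A) {f g : A → ℚ} → (∀ x → f x ≡ g x) → sumℚ (map f xs) ≡ sumℚ (map g xs)
sumℚ-cong []       p = refl
sumℚ-cong (x ∷ xs) p = cong₂ ℚ._+_ (p x) (sumℚ-cong xs p)

-- This is (b^r - 1)/2, by the recursion that `spline-compose` yields when N becomes bN.
half-width : ℕ → ℕ → ℕ
half-width b zero    = 0
half-width b (suc r) = half-width b r ℕ.+ b ℕ.^ r ℕ.* ⌊ b /2⌋

b^r≡1+2·half-width : ∀ b r → b ≡ suc (⌊ b /2⌋ ℕ.+ ⌊ b /2⌋) → b ℕ.^ r ≡ suc (half-width b r ℕ.+ half-width b r)
b^r≡1+2·half-width b zero    b≡ = refl
b^r≡1+2·half-width b (suc r) b≡ = begin
  b ℕ.* N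
    ≡⟨ cong (ℕ._* N) b≡ ⟩
  N ℕ.+ (c ℕ.+ c) ℕ.* N
    ≡⟨ cong (ℕ._+ (c ℕ.+ c) ℕ.* N) (b^r≡1+2·half-width b r b≡) ⟩
  suc (M ℕ.+ M) ℕ.+ (c ℕ.+ c) ℕ.* N
    ≡⟨ lem M N c ⟩
  suc ((M ℕ.+ N ℕ.* c) ℕ.+ (M ℕ.+ N ℕ.* c)) ∎
  where
  N M c : ℕ
  N = b ℕ.^ r
  M = half-width b r
  c = ⌊ b /2⌋
  lem : ∀ M N c → 1 ℕ.+ (M ℕ.+ M) ℕ.+ (c ℕ.+ c) ℕ.* N ≡ 1 ℕ.+ ((M ℕ.+ N ℕ.* c) ℕ.+ (M ℕ.+ N ℕ.* c))
  lem = ℕ-Ring.solve-∀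

^-distribʳ-* : ∀ n a b → (a ℕ.* b) ℕ.^ n ≡ a ℕ.^ n ℕ.* b ℕ.^ n
^-distribʳ-* zero    a b = refl
^-distribʳ-* (suc n) a b = trans (cong (a ℕ.* b ℕ.*_) (^-distribʳ-* n a b)) (lem a b (a ℕ.^ n) (b ℕ.^ n))
  where
  lem : ∀ a b x y → a ℕ.* b ℕ.* (x ℕ.* y) ≡ a ℕ.* x ℕ.* (b ℕ.* y)
  lem = ℕ-Ring.solve-∀

S-1 : ∀ h f u → S h 1 f u ≡ f u
S-1 h f u = +-identityʳ (f u)

It-1 : ∀ h m f u → It h 1 m f u ≡ f u
It-1 h zero    f u = refl
It-1 h (suc m) f u = trans (S-1 h (It h 1 m f) u) (It-1 h m f u)

K≡spline : ∀ b n i j → b ≡ suc (⌊ b /2⌋ ℕ.+ ⌊ b /2⌋) →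
  K b n i j ≡ spline b (suc n) (i - + suc n * + ⌊ b /2⌋ - j * + b) ÷ℕ (b ℕ.^ n)
K≡spline b n i j b≡ = cong (_÷ℕ (b ℕ.^ n)) (count≡spline b ⌊ b /2⌋ n i j b≡)

-- The right side is the one-step formula `K≡spline` from state 0 with base b^r. At r = 0 the base
-- is 1, whose only digit is 0, and the spline is `δ`.
Kpow≡spline : ∀ b n r j → b ≡ suc (⌊ b /2⌋ ℕ.+ ⌊ b /2⌋) → n ≡ ⌊ n /2⌋ ℕ.+ ⌊ n /2⌋ →
  Kpow b n r (+ 0) j ≡ spline (b ℕ.^ r) (suc n) (- (+ suc n * + half-width b r) - j * + (b ℕ.^ r)) ÷ℕ ((b ℕ.^ r) ℕ.^ n)
Kpow≡spline b n zero j b≡ n≡ = trans (base j) (cong₂ _÷ℕ_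
  (sym (trans (It-1 (+ 1) (suc n) δ _) (cong δ (lem (+ suc n) j))))
  (sym (ℕₚ.^-zeroˡ n)))
  where
  lem : ∀ m j → - (m * + 0) - j * + 1 ≡ - j
  lem = solve-∀
  base : ∀ j → Kpow b n 0 (+ 0) j ≡ δ (- j) ÷ℕ 1
  base (+ zero)  = refl
  base (+ suc j) = refl
  base -[1+ j ]  = refl
Kpow≡spline b n (suc r) j b≡ n≡ = begin
  sumℚ (map (λ k → Kpow b n r (+ 0) k ℚ.* K b n k j) (states n))
    ≡⟨ sumℚ-cong (states n) (λ k → trans
         (cong₂ ℚ._*_ (Kpow≡spline b n r k b≡ n≡) (K≡spline b n k j b≡))
         (÷ℕ-* (P k) (Q k) (N ℕ.^ n) (b ℕ.^ n))) ⟩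
  sumℚ (map (λ k → (P k * Q k) ÷ℕ (N ℕ.^ n ℕ.* b ℕ.^ n)) (states n))
    ≡⟨ sumℚ-÷ℕ (states n) (λ k → P k * Q k) (N ℕ.^ n ℕ.* b ℕ.^ n) ⟩
  ∑ (states n) (λ k → P k * Q k) ÷ℕ (N ℕ.^ n ℕ.* b ℕ.^ n)
    ≡⟨ cong₂ _÷ℕ_ compose (trans (ℕₚ.*-comm (N ℕ.^ n) (b ℕ.^ n)) (sym (^-distribʳ-* n b N))) ⟩
  spline (b ℕ.* N) (suc n) (- (+ suc n * + (M ℕ.+ N ℕ.* c)) - j * + (b ℕ.* N)) ÷ℕ ((b ℕ.* N) ℕ.^ n) ∎
  where
  N M c h : ℕ
  N = b ℕ.^ r
  M = half-width b r
  c = ⌊ b /2⌋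
  h = ⌊ n /2⌋
  P Q : ℤ → ℤ
  P k = spline N (suc n) (- (+ suc n * + M) - k * + N)
  Q k = spline b (suc n) (k - + suc n * + c - j * + b)
  instance
    b≢0 : ℕ.NonZero b
    b≢0 = subst ℕ.NonZero (sym b≡) _
    b^n≢0 : ℕ.NonZero (b ℕ.^ n)
    b^n≢0 = ℕₚ.m^n≢0 b n
    N≢0 : ℕ.NonZero N
    N≢0 = ℕₚ.m^n≢0 b r
    N^n≢0 : ℕ.NonZero (N ℕ.^ n)
    N^n≢0 = ℕₚ.m^n≢0 N n
  compose : ∑ (states n) (λ k → P k * Q k)
    ≡ spline (b ℕ.* N) (suc n) (- (+ suc n * + (M ℕ.+ N ℕ.* c)) - j * + (b ℕ.* N))
  compose = trans
    (subst (λ n → ∑ (range (- + h) (suc n)) (λ k → spline N (suc n) (- (+ suc n * + M) - k * + N)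
          * spline b (suc n) (k - + suc n * + c - j * + b))
        ≡ spline (b ℕ.* N) (suc n) (- (+ suc n * (+ M + + N * + c)) - j * + (b ℕ.* N)))
      (sym n≡) (spline-compose h M c b N j (b^r≡1+2·half-width b r b≡) b≡))
    (cong (λ v → spline (b ℕ.* N) (suc n) (- (+ suc n * (+ M + v)) - j * + (b ℕ.* N))) (sym (ℤₚ.pos-* N c)))

-- Arrangements of signed letters by descents

picks : List ℕ → List (ℕ × List ℕ)
picks []       = []
picks (s ∷ xs) = (s , xs) ∷ map (λ p → proj₁ p , s ∷ proj₂ p) (picks xs)

-- Sum of f over the words that use each absolute value of xs once, with either sign
-- (provided xs has length m).
Arr : ℕ → List ℕ → (List ℤ → ℤ) → ℤ
Arr zero    xs f = f []
Arr (suc m) xs f = ∑ (picks xs) λ p →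
  Arr m (proj₂ p) (λ w → f (+ proj₁ p ∷ w)) + Arr m (proj₂ p) (λ w → f (- + proj₁ p ∷ w))

Arr-cong : ∀ m xs {f g} → (∀ w → f w ≡ g w) → Arr m xs f ≡ Arr m xs g
Arr-cong zero    xs p = p []
Arr-cong (suc m) xs p = ∑-cong (picks xs) λ q →
  cong₂ _+_ (Arr-cong m (proj₂ q) (λ w → p _)) (Arr-cong m (proj₂ q) (λ w → p _))

Arr-+ : ∀ m xs f g → Arr m xs (λ w → f w + g w) ≡ Arr m xs f + Arr m xs g
Arr-+ zero    xs f g = refl
Arr-+ (suc m) xs f g = trans
  (∑-cong (picks xs) λ q → trans (cong₂ _+_ (Arr-+ m (proj₂ q) _ _) (Arr-+ m (proj₂ q) _ _))
    (+-inter (Arr m (proj₂ q) (λ w → f (+ proj₁ q ∷ w))) _ _ _))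
  (∑-+ (picks xs) _ _)

Arr-*ˡ : ∀ m xs c f → Arr m xs (λ w → c * f w) ≡ c * Arr m xs f
Arr-*ˡ zero    xs c f = refl
Arr-*ˡ (suc m) xs c f = trans
  (∑-cong (picks xs) λ q → trans (cong₂ _+_ (Arr-*ˡ m (proj₂ q) c _) (Arr-*ˡ m (proj₂ q) c _))
    (sym (ℤₚ.*-distribˡ-+ c _ _)))
  (∑-*ˡ (picks xs) c _)

picks-All : ∀ {P : ℕ → Set} {xs} → All P xs → All (λ q → P (proj₁ q) × All P (proj₂ q)) (picks xs)
picks-All []       = []
picks-All (p ∷ ps) = (p , ps) ∷ map⁺ (All.map (λ (pt , pT) → pt , p ∷ pT) (picks-All ps))

picks-AllPairs : ∀ {P : ℕ → ℕ → Set} {xs} → AllPairs P xs → All (λ q → AllPairs P (proj₂ q)) (picks xs)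
picks-AllPairs []       = []
picks-AllPairs (p ∷ ps) = ps ∷ map⁺ (All.zipWith (λ ((_ , pT) , psT) → pT ∷ psT) (picks-All p , picks-AllPairs ps))

picks-length : ∀ xs → All (λ q → suc (length (proj₂ q)) ≡ length xs) (picks xs)
picks-length []       = []
picks-length (s ∷ xs) = refl ∷ map⁺ (All.map (cong suc) (picks-length xs))

Sorted : List ℕ → Set
Sorted = AllPairs ℕ._<_

Between : ℕ → ℕ → Set
Between n s = 1 ℕ.≤ s × s ℕ.≤ n

-- Letters are not renumbered after a deletion, since `key n` refers to the original n; the
-- induction runs over subsets of {1, ..., n}. Sorting puts the least absolute value at the head and
-- excludes repetitions.
Good : ℕ → ℕ → List ℕ → Set
Good n m xs = length xs ≡ m × Sorted xs × All (Between n) xs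

picks-Good : ∀ {n m xs} → Good n (suc m) xs → All (λ q → Between n (proj₁ q) × Good n m (proj₂ q)) (picks xs)
picks-Good {xs = xs} (len , sorted , between) =
  All.zipWith (λ { ((lenT , sortedT) , (s∈ , T∈)) → s∈ , ℕₚ.suc-injective (trans lenT len) , sortedT , T∈ })
    (All.zip (picks-length xs , picks-AllPairs sorted) , picks-All between)

picks-Good-∷ : ∀ {n m s xs} → Good n (suc (suc m)) (s ∷ xs) →
  All (λ q → (s ℕ.< proj₁ q × proj₁ q ℕ.≤ n) × Good n (suc m) (s ∷ proj₂ q)) (picks xs)
picks-Good-∷ {xs = xs} (len , s< ∷ sorted , (s∈ ∷ between)) =
  All.zipWith (λ { ((lenT , sortedT) , ((s<t , s<T) , (t∈ , T∈))) →
      (s<t , proj₂ t∈) , trans lenT (ℕₚ.suc-injective len) , (s<T ∷ sortedT) , (s∈ ∷ T∈) })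
    (All.zip (picks-length xs , picks-AllPairs sorted) , All.zip (picks-All s< , picks-All between))

descent : ℕ → ℤ → ℤ → ℕ
descent n x y = if key n x ≤ᵇ key n y then 0 else 1

-- |x| > s puts x strictly between s, the least letter, and -s, the greatest.
record _AboveIn_ (x : ℤ) (ns : ℕ × ℕ) : Set where
  private
    n = proj₁ ns
    s = proj₂ ns
  field
    x→+s : descent n x (+ s) ≡ 1
    x→-s : descent n x (- + s) ≡ 0
    +s→x : descent n (+ s) x ≡ 0
    -s→x : descent n (- + s) x ≡ 1

descent-0 : ∀ n x y k → key n y ≡ key n x + + k → descent n x y ≡ 0
descent-0 n x y k eq = cong (λ b → if b then 0 else 1)
  (trans (cong (key n x ≤ᵇ_) eq) (x≤ᵇx+k (key n x) k))

descent-1 : ∀ n x y k → key n x ≡ key n y + + suc k → descent n x y ≡ 1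
descent-1 n x y k eq = cong (λ b → if b then 0 else 1)
  (trans (cong (_≤ᵇ key n y) eq) (x+k≰ᵇx (key n y) k))

above : ∀ n s t → 1 ℕ.≤ s → s ℕ.< t → t ℕ.≤ n → ((+ t) AboveIn (n , s)) × ((- + t) AboveIn (n , s))
above n (suc s) t _ s<t t≤n with ℕₚ.m≤n⇒∃[o]m+o≡n s<t | ℕₚ.m≤n⇒∃[o]m+o≡n t≤n
... | d , refl | u , refl = record
    { x→+s = descent-1 n (+ t) (+ suc s) d (near (+ s) (+ d))
    ; x→-s = descent-0 n (+ t) (- + suc s) (suc k) (far (+ s) (+ d) (+ u))
    ; +s→x = descent-0 n (+ suc s) (+ t) (suc d) (near (+ s) (+ d))
    ; -s→x = descent-1 n (- + suc s) (+ t) k (far (+ s) (+ d) (+ u))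
    } , record
    { x→+s = descent-1 n (- + t) (+ suc s) k (far′ (+ s) (+ d) (+ u))
    ; x→-s = descent-0 n (- + t) (- + suc s) (suc d) (near′ (+ s) (+ d) (+ (2 ℕ.* n ℕ.+ 1)))
    ; +s→x = descent-0 n (+ suc s) (- + t) (suc k) (far′ (+ s) (+ d) (+ u))
    ; -s→x = descent-1 n (- + suc s) (- + t) d (near′ (+ s) (+ d) (+ (2 ℕ.* n ℕ.+ 1)))
    }
  where
  k : ℕ
  -- `suc k` is the key gap from t to the negative of `suc s`, and equally from `suc s` to -t: 2n +
  -- 1 minus both absolute values.
  k = 1 ℕ.+ d ℕ.+ (u ℕ.+ u)
  near : ∀ s d → + 2 + s + d ≡ + 1 + s + (+ 1 + d)
  near = solve-∀
  near′ : ∀ s d w → - (+ 1 + s) + w ≡ - (+ 2 + s + d) + w + (+ 1 + d)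
  near′ = solve-∀
  far : ∀ s d u → let t = + 2 + s + d ; n = t + u in
    - (+ 1 + s) + (n + (n + + 0) + + 1) ≡ t + (+ 1 + (+ 1 + d + (u + u)))
  far = solve-∀
  far′ : ∀ s d u → let t = + 2 + s + d ; n = t + u in
    - t + (n + (n + + 0) + + 1) ≡ + 1 + s + (+ 1 + (+ 1 + d + (u + u)))
  far′ = solve-∀

-- Inserting ±s into a word keeps the number of descents at a descent and
-- raises it by one elsewhere: insert sums φ over the positions after the
-- first letter of a word with m + 1 letters, insert⁰ over all positions.
insert : ℕ → (ℕ → ℤ) → ℕ → ℤ
insert m φ d = + 2 * + d * φ d + + 2 * (+ m + + 1 - + d) * φ (suc d)

insert⁰ : ℕ → (ℕ → ℤ) → ℕ → ℤ
insert⁰ m φ d = (+ 2 * + d + + 1) * φ d + (+ 2 * + m + + 1 - + 2 * + d) * φ (suc d)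

After : ℕ → ℕ → List ℕ → (ℕ → ℤ) → ℤ → ℤ
After n m xs φ x = Arr m xs (λ w → φ (desc n (x ∷ w)))

-- The weight `Φ` may depend on the new first letter, because the descent from the preceding letter
-- to it shifts the count.
After± : ℕ → ℕ → (ℤ → ℕ → ℤ) → ℕ × List ℕ → ℤ
After± n m Φ p = After n m (proj₂ p) (Φ (+ proj₁ p)) (+ proj₁ p) + After n m (proj₂ p) (Φ (- + proj₁ p)) (- + proj₁ p)

After-cong : ∀ n m xs {φ ψ} x → (∀ d → φ d ≡ ψ d) → After n m xs φ x ≡ After n m xs ψ x
After-cong n m xs x p = Arr-cong m xs (λ w → p (desc n (x ∷ w)))

After-+ : ∀ n m xs φ ψ x → After n m xs (λ d → φ d + ψ d) x ≡ After n m xs φ x + After n m xs ψ x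
After-+ n m xs φ ψ x = Arr-+ m xs _ _

After±-+ : ∀ n m Φ Ψ p → After± n m Φ p + After± n m Ψ p ≡ After± n m (λ x d → Φ x d + Ψ x d) p
After±-+ n m Φ Ψ (s , xs) = trans
  (+-inter (After n m xs (Φ (+ s)) (+ s)) _ _ _)
  (sym (cong₂ _+_ (After-+ n m xs (Φ (+ s)) (Ψ (+ s)) (+ s)) (After-+ n m xs (Φ (- + s)) (Ψ (- + s)) (- + s))))

-- The letter s lies below every letter that can follow it, so erasing it loses no descent.
after-min : ∀ n m s xs φ → Good n (suc (suc m)) (s ∷ xs) →
  After n (suc m) xs φ (+ s) ≡ ∑ (picks xs) (After± n m (λ _ → φ))
after-min n m s xs φ good@(_ , _ , (1≤s , _) ∷ _) = ∑-congAll (All.map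
  (λ { {t , ys} ((s<t , t≤n) , _) → let ↑ , ↑′ = above n s t 1≤s s<t t≤n in cong₂ _+_
    (After-cong n m ys (+ t) (λ d → cong (λ e → φ (e ℕ.+ d)) (+s→x ↑)))
    (After-cong n m ys (- + t) (λ d → cong (λ e → φ (e ℕ.+ d)) (+s→x ↑′))) })
  (picks-Good-∷ good))
  where open _AboveIn_

-- The letter -s lies above every letter that can follow it, so erasing it loses exactly one
-- descent.
after-max : ∀ n m s xs φ → Good n (suc (suc m)) (s ∷ xs) →
  After n (suc m) xs φ (- + s) ≡ ∑ (picks xs) (After± n m (λ _ d → φ (suc d)))
after-max n m s xs φ good@(_ , _ , (1≤s , _) ∷ _) = ∑-congAll (All.map
  (λ { {t , ys} ((s<t , t≤n) , _) → let ↑ , ↑′ = above n s t 1≤s s<t t≤n in cong₂ _+_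
    (After-cong n m ys (+ t) (λ d → cong (λ e → φ (e ℕ.+ d)) (-s→x ↑)))
    (After-cong n m ys (- + t) (λ d → cong (λ e → φ (e ℕ.+ d)) (-s→x ↑′))) })
  (picks-Good-∷ good))
  where open _AboveIn_

-- Between x and y either sign of s makes exactly one descent: x → s for the least letter, -s → y
-- for the greatest. Both words count d + 1, which is a gain only where x → y was an ascent.
insert-step : ∀ m φ x→y d → (x→y ≡ 0) ⊎ (x→y ≡ 1) →
  φ (suc d) + φ (suc d) + insert m (λ d → φ (x→y ℕ.+ d)) d ≡ insert (suc m) φ (x→y ℕ.+ d)
insert-step m φ _ d (inj₁ refl) = lem (+ m) (+ d) (φ d) (φ (suc d))
  where
  lem : ∀ m d a b → b + b + (+ 2 * d * a + + 2 * (m + + 1 - d) * b)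
    ≡ + 2 * d * a + + 2 * (+ 1 + m + + 1 - d) * b
  lem = solve-∀
insert-step m φ _ d (inj₂ refl) = lem (+ m) (+ d) (φ (suc d)) (φ (suc (suc d)))
  where
  lem : ∀ m d a b → a + a + (+ 2 * d * a + + 2 * (m + + 1 - d) * b)
    ≡ + 2 * (+ 1 + d) * a + + 2 * (+ 1 + m + + 1 - (+ 1 + d)) * b
  lem = solve-∀

descent-cases : ∀ n x y → (descent n x y ≡ 0) ⊎ (descent n x y ≡ 1)
descent-cases n x y with key n x ≤ᵇ key n y
... | true  = inj₁ refl
... | false = inj₂ refl

desc-[x]-cases : ∀ n x → (desc n (x ∷ []) ≡ 0) ⊎ (desc n (x ∷ []) ≡ 1)
desc-[x]-cases n (+ k)    = inj₁ refl
desc-[x]-cases n -[1+ k ] = inj₂ refl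

-- Either ±s follows x directly and is erased by `after-min` or `after-max`, or a letter y comes
-- first and the induction hypothesis applies after y. `insert-step` combines the two.
after-∷ : ∀ n m s xs φ x → Good n (suc m) (s ∷ xs) → x AboveIn (n , s) →
  After n (suc m) (s ∷ xs) φ x ≡ After n m xs (insert m φ) x
after-∷ n zero (suc s) [] φ x good ↑ = begin
  φ (descent n x (+ suc s) ℕ.+ 0) + φ (descent n x (- + suc s) ℕ.+ 1) + + 0
    ≡⟨ cong₂ (λ e e′ → φ (e ℕ.+ 0) + φ (e′ ℕ.+ 1) + + 0) (_AboveIn_.x→+s ↑) (_AboveIn_.x→-s ↑) ⟩
  φ 1 + φ 1 + + 0
    ≡⟨ last (desc-[x]-cases n x) ⟩
  insert 0 φ (desc n (x ∷ [])) ∎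
  where
  -- A descent at the last position means a negative last letter, so the end of the word acts as a
  -- letter above the positive and below the negative ones. Appending either sign of s leaves one
  -- descent, a gain only if e = 0.
  last : ∀ {e} → (e ≡ 0) ⊎ (e ≡ 1) → φ 1 + φ 1 + + 0 ≡ insert 0 φ e
  last (inj₁ refl) = lem (φ 0) (φ 1)
    where
    lem : ∀ a b → b + b + + 0 ≡ + 2 * + 0 * a + + 2 * (+ 0 + + 1 - + 0) * b
    lem = solve-∀
  last (inj₂ refl) = lem (φ 1) (φ 2)
    where
    lem : ∀ a b → a + a + + 0 ≡ + 2 * + 1 * a + + 2 * (+ 0 + + 1 - + 1) * b
    lem = solve-∀
after-∷ n zero zero [] φ x (_ , _ , (() , _) ∷ _) ↑
after-∷ n (suc m) s xs φ x good@(_ , _ , (1≤s , _) ∷ _) ↑ = begin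
  After n (suc m) xs (λ d → φ (descent n x (+ s) ℕ.+ d)) (+ s)
    + After n (suc m) xs (λ d → φ (descent n x (- + s) ℕ.+ d)) (- + s)
    + ∑ (map (λ p → proj₁ p , s ∷ proj₂ p) (picks xs)) (After± n (suc m) (λ y d → φ (descent n x y ℕ.+ d)))
    ≡⟨ cong₂ _+_ (cong₂ _+_
         (trans (After-cong n (suc m) xs (+ s) (λ d → cong (λ e → φ (e ℕ.+ d)) (_AboveIn_.x→+s ↑)))
           (after-min n m s xs (λ d → φ (suc d)) good))
         (trans (After-cong n (suc m) xs (- + s) (λ d → cong (λ e → φ (e ℕ.+ d)) (_AboveIn_.x→-s ↑)))
           (after-max n m s xs φ good)))
         (trans (∑-map _ (picks xs) _) (∑-congAll (All.map (λ { {t , ys} → ih t ys }) (picks-Good-∷ good)))) ⟩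
  ∑ (picks xs) (After± n m (λ _ d → φ (suc d))) + ∑ (picks xs) (After± n m (λ _ d → φ (suc d)))
    + ∑ (picks xs) (After± n m (λ y → insert m (λ d → φ (descent n x y ℕ.+ d))))
    ≡⟨ trans (cong (_+ ∑ (picks xs) (After± n m (λ y → insert m (λ d → φ (descent n x y ℕ.+ d))))) (sym (∑-+ (picks xs) _ _))) (sym (∑-+ (picks xs) _ _)) ⟩
  ∑ (picks xs) (λ p → After± n m (λ _ d → φ (suc d)) p + After± n m (λ _ d → φ (suc d)) p
    + After± n m (λ y → insert m (λ d → φ (descent n x y ℕ.+ d))) p)
    ≡⟨ ∑-cong (picks xs) combine ⟩
  ∑ (picks xs) (After± n m (λ y d → insert (suc m) φ (descent n x y ℕ.+ d))) ∎
  where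
  ih : ∀ t ys → (s ℕ.< t × t ℕ.≤ n) × Good n (suc m) (s ∷ ys) →
    After± n (suc m) (λ y d → φ (descent n x y ℕ.+ d)) (t , s ∷ ys)
    ≡ After± n m (λ y → insert m (λ d → φ (descent n x y ℕ.+ d))) (t , ys)
  ih t ys ((s<t , t≤n) , good′) = let ↑₊ , ↑₋ = above n s t 1≤s s<t t≤n in cong₂ _+_
    (after-∷ n m s ys (λ d → φ (descent n x (+ t) ℕ.+ d)) (+ t) good′ ↑₊)
    (after-∷ n m s ys (λ d → φ (descent n x (- + t) ℕ.+ d)) (- + t) good′ ↑₋)
  combine : ∀ p → After± n m (λ _ d → φ (suc d)) p + After± n m (λ _ d → φ (suc d)) p
      + After± n m (λ y → insert m (λ d → φ (descent n x y ℕ.+ d))) p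
    ≡ After± n m (λ y d → insert (suc m) φ (descent n x y ℕ.+ d)) p
  combine p@(t , ys) = trans
    (trans (cong (_+ After± n m (λ y → insert m (λ d → φ (descent n x y ℕ.+ d))) p)
             (After±-+ n m (λ _ d → φ (suc d)) (λ _ d → φ (suc d)) p))
           (After±-+ n m (λ _ d → φ (suc d) + φ (suc d)) (λ y → insert m (λ d → φ (descent n x y ℕ.+ d))) p))
    (cong₂ _+_
      (After-cong n m ys (+ t) (λ d → insert-step m φ (descent n x (+ t)) d (descent-cases n x (+ t))))
      (After-cong n m ys (- + t) (λ d → insert-step m φ (descent n x (- + t)) d (descent-cases n x (- + t)))))

-- The front gap is the asymmetric one: s adds no descent there and -s adds one. It contributes one
-- to each coefficient of `insert`, which makes both odd.
Arr-desc-∷ : ∀ n m s xs φ → Good n (suc m) (s ∷ xs) →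
  Arr (suc m) (s ∷ xs) (λ w → φ (desc n w)) ≡ Arr m xs (λ w → insert⁰ m φ (desc n w))
Arr-desc-∷ n zero (suc s) [] φ good = lem (φ 0) (φ 1)
  where
  lem : ∀ a b → a + b + + 0 ≡ (+ 2 * + 0 + + 1) * a + (+ 2 * + 0 + + 1 - + 2 * + 0) * b
  lem = solve-∀
Arr-desc-∷ n zero zero [] φ (_ , _ , (() , _) ∷ _)
Arr-desc-∷ n (suc m) s xs φ good@(_ , _ , (1≤s , _) ∷ _) = begin
  After n (suc m) xs φ (+ s) + After n (suc m) xs φ (- + s)
    + ∑ (map (λ p → proj₁ p , s ∷ proj₂ p) (picks xs)) (After± n (suc m) (λ _ → φ))
    ≡⟨ cong₂ _+_ (cong₂ _+_ (after-min n m s xs φ good) (after-max n m s xs φ good))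
         (trans (∑-map _ (picks xs) _) (∑-congAll (All.map (λ { {t , ys} → inner t ys }) (picks-Good-∷ good)))) ⟩
  ∑ (picks xs) (After± n m (λ _ → φ)) + ∑ (picks xs) (After± n m (λ _ d → φ (suc d)))
    + ∑ (picks xs) (After± n m (λ _ → insert m φ))
    ≡⟨ trans (cong (_+ ∑ (picks xs) (After± n m (λ _ → insert m φ))) (sym (∑-+ (picks xs) _ _))) (sym (∑-+ (picks xs) _ _)) ⟩
  ∑ (picks xs) (λ p → After± n m (λ _ → φ) p + After± n m (λ _ d → φ (suc d)) p + After± n m (λ _ → insert m φ) p)
    ≡⟨ ∑-cong (picks xs) combine ⟩
  ∑ (picks xs) (After± n m (λ _ → insert⁰ (suc m) φ)) ∎
  where
  inner : ∀ t ys → (s ℕ.< t × t ℕ.≤ n) × Good n (suc m) (s ∷ ys) →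
    After± n (suc m) (λ _ → φ) (t , s ∷ ys) ≡ After± n m (λ _ → insert m φ) (t , ys)
  inner t ys ((s<t , t≤n) , good′) = let ↑₊ , ↑₋ = above n s t 1≤s s<t t≤n in cong₂ _+_
    (after-∷ n m s ys φ (+ t) good′ ↑₊) (after-∷ n m s ys φ (- + t) good′ ↑₋)
  total : ∀ d → φ d + φ (suc d) + insert m φ d ≡ insert⁰ (suc m) φ d
  total d = lem (+ m) (+ d) (φ d) (φ (suc d))
    where
    lem : ∀ m d a b → a + b + (+ 2 * d * a + + 2 * (m + + 1 - d) * b)
      ≡ (+ 2 * d + + 1) * a + (+ 2 * (+ 1 + m) + + 1 - + 2 * d) * b
    lem = solve-∀
  combine : ∀ p → After± n m (λ _ → φ) p + After± n m (λ _ d → φ (suc d)) p + After± n m (λ _ → insert m φ) p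
    ≡ After± n m (λ _ → insert⁰ (suc m) φ) p
  combine p@(t , ys) = trans
    (trans (cong (_+ After± n m (λ _ → insert m φ) p) (After±-+ n m (λ _ → φ) (λ _ d → φ (suc d)) p))
           (After±-+ n m (λ _ d → φ d + φ (suc d)) (λ _ → insert m φ) p))
    (cong₂ _+_ (After-cong n m ys (+ t) total) (After-cong n m ys (- + t) total))

δ-neg : ∀ z → δ (- z) ≡ δ z
δ-neg (+ zero)  = refl
δ-neg (+ suc k) = refl
δ-neg -[1+ k ]  = refl

-- By zδ(z) = 0, the first coefficient may be read at d = J and the second at d = J - 1. They no
-- longer depend on the word and can leave the sum.
insert⁰-δ : ∀ m J d → insert⁰ m (λ d → δ (J - + d)) d
  ≡ (+ 2 * J + + 1) * δ (J - + d) + (+ 2 * + m + + 3 - + 2 * J) * δ (J - + 1 - + d)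
insert⁰-δ m J d = begin
  (+ 2 * + d + + 1) * a + (+ 2 * + m + + 1 - + 2 * + d) * δ (J - + suc d)
    ≡⟨ cong (λ v → (+ 2 * + d + + 1) * a + (+ 2 * + m + + 1 - + 2 * + d) * δ v) (l₁ J (+ d)) ⟩
  (+ 2 * + d + + 1) * a + (+ 2 * + m + + 1 - + 2 * + d) * b
    ≡⟨ l₂ (+ d) (+ m) J a b ⟩
  (+ 2 * J + + 1) * a + (+ 2 * + m + + 3 - + 2 * J) * b + (+ 2 * ((J - + 1 - + d) * b) - + 2 * ((J - + d) * a))
    ≡⟨ cong₂ (λ u v → (+ 2 * J + + 1) * a + (+ 2 * + m + + 3 - + 2 * J) * b + (+ 2 * u - + 2 * v))
         (z*δ[z]≡0 (J - + 1 - + d)) (z*δ[z]≡0 (J - + d)) ⟩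
  (+ 2 * J + + 1) * a + (+ 2 * + m + + 3 - + 2 * J) * b + + 0
    ≡⟨ +-identityʳ _ ⟩
  (+ 2 * J + + 1) * a + (+ 2 * + m + + 3 - + 2 * J) * b ∎
  where
  a b : ℤ
  a = δ (J - + d)
  b = δ (J - + 1 - + d)
  l₁ : ∀ J d → J - (+ 1 + d) ≡ J - + 1 - d
  l₁ = solve-∀
  l₂ : ∀ d m J a b → (+ 2 * d + + 1) * a + (+ 2 * m + + 1 - + 2 * d) * b
    ≡ (+ 2 * J + + 1) * a + (+ 2 * m + + 3 - + 2 * J) * b + (+ 2 * ((J - + 1 - d) * b) - + 2 * ((J - d) * a))
  l₂ = solve-∀

Arr-desc≡eulerianB : ∀ n m xs J → Good n m xs → Arr m xs (λ w → δ (J - + desc n w)) ≡ eulerianB m J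
Arr-desc≡eulerianB n zero    []       J good = cong δ (+-identityʳ J)
Arr-desc≡eulerianB n (suc m) (s ∷ xs) J good@(len , _ ∷ sorted , _ ∷ between) = begin
  Arr (suc m) (s ∷ xs) (λ w → δ (J - + desc n w))
    ≡⟨ Arr-desc-∷ n m s xs (λ d → δ (J - + d)) good ⟩
  Arr m xs (λ w → insert⁰ m (λ d → δ (J - + d)) (desc n w))
    ≡⟨ Arr-cong m xs (λ w → insert⁰-δ m J (desc n w)) ⟩
  Arr m xs (λ w → α * δ (J - + desc n w) + β * δ (J - + 1 - + desc n w))
    ≡⟨ Arr-+ m xs _ _ ⟩
  Arr m xs (λ w → α * δ (J - + desc n w)) + Arr m xs (λ w → β * δ (J - + 1 - + desc n w))
    ≡⟨ cong₂ _+_ (Arr-*ˡ m xs α _) (Arr-*ˡ m xs β _) ⟩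
  α * Arr m xs (λ w → δ (J - + desc n w)) + β * Arr m xs (λ w → δ (J - + 1 - + desc n w))
    ≡⟨ cong₂ (λ u v → α * u + β * v) (Arr-desc≡eulerianB n m xs J good′) (Arr-desc≡eulerianB n m xs (J - + 1) good′) ⟩
  eulerianB (suc m) J ∎
  where
  α β : ℤ
  α = + 2 * J + + 1
  β = + 2 * + m + + 3 - + 2 * J
  good′ : Good n m xs
  good′ = ℕₚ.suc-injective len , sorted , between

-- Signed permutations

member : ℕ → List ℕ → Bool
member a = any (a ℕ.≡ᵇ_)

remove : ℕ → List ℕ → List ℕ
remove a []       = []
remove a (s ∷ xs) = if a ℕ.≡ᵇ s then xs else s ∷ remove a xs

≡ᵇ-true : ∀ {a s} → (a ℕ.≡ᵇ s) ≡ true → a ≡ s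
≡ᵇ-true {a} {s} eq = ℕₚ.≡ᵇ⇒≡ a s (subst T (sym eq) tt)

≢⇒≡ᵇ-false : ∀ {a s} → ¬ (a ≡ s) → (a ℕ.≡ᵇ s) ≡ false
≢⇒≡ᵇ-false {a} {s} a≢s with a ℕ.≡ᵇ s in eq
... | true  = contradiction (≡ᵇ-true eq) a≢s
... | false = refl

≡ᵇ-refl : ∀ a → (a ℕ.≡ᵇ a) ≡ true
≡ᵇ-refl zero    = refl
≡ᵇ-refl (suc a) = ≡ᵇ-refl a

≡ᵇ-sym : ∀ a b → (a ℕ.≡ᵇ b) ≡ (b ℕ.≡ᵇ a)
≡ᵇ-sym zero    zero    = refl
≡ᵇ-sym zero    (suc b) = refl
≡ᵇ-sym (suc a) zero    = refl
≡ᵇ-sym (suc a) (suc b) = ≡ᵇ-sym a b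

member-< : ∀ {a xs} → All (a ℕ.<_) xs → member a xs ≡ false
member-< []         = refl
member-< {a} (_∷_ {x} a<x ps) rewrite ≢⇒≡ᵇ-false {a} {x} (ℕₚ.<⇒≢ a<x) = member-< ps

-- A sorted list has no repetitions, so at most one pick matches a, and its rest is `remove a xs`.
∑-picks : ∀ a xs (H : List ℕ → ℤ) → Sorted xs →
  ∑ (picks xs) (λ p → ⟦ a ℕ.≡ᵇ proj₁ p ⟧ * H (proj₂ p)) ≡ ⟦ member a xs ⟧ * H (remove a xs)
∑-picks a []       H _ = sym (*-zeroˡ (H []))
∑-picks a (s ∷ xs) H (s< ∷ sorted) with a ℕ.≡ᵇ s in eq
... | true = trans
  (cong (_+_ (+ 1 * H xs)) (trans (∑-map _ (picks xs) _)
    (trans (∑-congAll (All.map none (picks-All s<))) (∑-zero (picks xs)))))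
  (+-identityʳ _)
  where
  none : ∀ {p} → s ℕ.< proj₁ p × All (s ℕ.<_) (proj₂ p) → ⟦ a ℕ.≡ᵇ proj₁ p ⟧ * H (s ∷ proj₂ p) ≡ + 0
  none {t , ys} (s<t , _) = trans
    (cong (λ b → ⟦ b ⟧ * H (s ∷ ys)) (≢⇒≡ᵇ-false {a} {t} (λ a≡t → ℕₚ.<⇒≢ s<t (trans (sym (≡ᵇ-true {a} {s} eq)) a≡t))))
    (*-zeroˡ (H (s ∷ ys)))
... | false = trans (cong₂ _+_ (*-zeroˡ (H xs)) (∑-map _ (picks xs) _))
  (trans (+-identityˡ _) (∑-picks a xs (λ ys → H (s ∷ ys)) sorted))

member-remove : ∀ a y xs → Sorted xs → member y (remove a xs) ≡ member y xs ∧ not (a ℕ.≡ᵇ y)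
member-remove a y []       _ = refl
member-remove a y (s ∷ xs) (s< ∷ sorted) with a ℕ.≡ᵇ s in eq
... | true rewrite ≡ᵇ-true {a} {s} eq | ≡ᵇ-sym s y with y ℕ.≡ᵇ s in eq′
...   | true rewrite ≡ᵇ-true {y} {s} eq′ = member-< s<
...   | false with member y xs
...     | true  = refl
...     | false = refl
member-remove a y (s ∷ xs) (s< ∷ sorted) | false rewrite member-remove a y xs sorted with y ℕ.≡ᵇ s in eq′
... | true rewrite ≡ᵇ-true {y} {s} eq′ | eq = refl
... | false = refl

lettersIn : List ℕ → List ℤ → Bool
lettersIn xs = all (λ x → member ℤ.∣ x ∣ xs)

lettersIn-remove : ∀ a xs w → Sorted xs →
  lettersIn (remove a xs) w ≡ lettersIn xs w ∧ not (member a (map ℤ.∣_∣ w))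
lettersIn-remove a xs []      sorted = refl
lettersIn-remove a xs (x ∷ w) sorted
  rewrite member-remove a ℤ.∣ x ∣ xs sorted | lettersIn-remove a xs w sorted
  with member ℤ.∣ x ∣ xs | a ℕ.≡ᵇ ℤ.∣ x ∣ | lettersIn xs w
... | true  | true  | true  = refl
... | true  | true  | false = refl
... | true  | false | true  = refl
... | true  | false | false = refl
... | false | true  | _     = refl
... | false | false | _     = refl

-- `isSignedPerm` with {1, ..., n} replaced by any set of absolute values, so that letters can be
-- peeled off one at a time.
arranges : ℕ → List ℕ → List ℤ → Bool
arranges m xs w = (length w ℕ.≡ᵇ m) ∧ lettersIn xs w ∧ distinct (map ℤ.∣_∣ w)

arranges-∷ : ∀ m xs x w → Sorted xs →
  ⟦ arranges (suc m) xs (x ∷ w) ⟧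
  ≡ ∑ (picks xs) (λ p → ⟦ ℤ.∣ x ∣ ℕ.≡ᵇ proj₁ p ⟧ * ⟦ arranges m (proj₂ p) w ⟧)
arranges-∷ m xs x w sorted = sym (begin
  ∑ (picks xs) (λ p → ⟦ a ℕ.≡ᵇ proj₁ p ⟧ * ⟦ arranges m (proj₂ p) w ⟧)
    ≡⟨ ∑-picks a xs (λ ys → ⟦ arranges m ys w ⟧) sorted ⟩
  ⟦ member a xs ⟧ * ⟦ arranges m (remove a xs) w ⟧
    ≡⟨ sym (⟦⟧-∧ (member a xs) _) ⟩
  ⟦ member a xs ∧ (length w ℕ.≡ᵇ m) ∧ lettersIn (remove a xs) w ∧ distinct (map ℤ.∣_∣ w) ⟧
    ≡⟨ cong (λ b → ⟦ member a xs ∧ (length w ℕ.≡ᵇ m) ∧ b ∧ distinct (map ℤ.∣_∣ w) ⟧) (lettersIn-remove a xs w sorted) ⟩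
  ⟦ member a xs ∧ (length w ℕ.≡ᵇ m) ∧ (lettersIn xs w ∧ not (member a (map ℤ.∣_∣ w))) ∧ distinct (map ℤ.∣_∣ w) ⟧
    ≡⟨ cong ⟦_⟧ (shuffle (member a xs) (length w ℕ.≡ᵇ m) (lettersIn xs w) (not (member a (map ℤ.∣_∣ w))) (distinct (map ℤ.∣_∣ w))) ⟩
  ⟦ (length w ℕ.≡ᵇ m) ∧ (member a xs ∧ lettersIn xs w) ∧ (not (member a (map ℤ.∣_∣ w)) ∧ distinct (map ℤ.∣_∣ w)) ⟧ ∎)
  where
  a : ℕ
  a = ℤ.∣ x ∣
  shuffle : ∀ p q r s t → p ∧ q ∧ (r ∧ s) ∧ t ≡ q ∧ (p ∧ r) ∧ (s ∧ t)
  shuffle true  true  true  s t = refl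
  shuffle true  true  false s t = refl
  shuffle true  false r     s t = refl
  shuffle false true  r     s t = refl
  shuffle false false r     s t = refl

⟦≡ᵇ⟧ : ∀ d j → ⟦ d ℕ.≡ᵇ j ⟧ ≡ δ (+ j - + d)
⟦≡ᵇ⟧ zero    zero    = refl
⟦≡ᵇ⟧ zero    (suc j) = refl
⟦≡ᵇ⟧ (suc d) zero    = refl
⟦≡ᵇ⟧ (suc d) (suc j) = trans (⟦≡ᵇ⟧ d j) (cong δ (lem (+ j) (+ d)))
  where
  lem : ∀ j d → j - d ≡ + 1 + j - (+ 1 + d)
  lem = solve-∀

-- The successor keeps the two signed letters apart; at 0 the right side would count x = 0 twice.
⟦∣x∣≡ᵇs⟧ : ∀ x s → ⟦ ℤ.∣ x ∣ ℕ.≡ᵇ suc s ⟧ ≡ δ (+ suc s - x) + δ (- + suc s - x)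
⟦∣x∣≡ᵇs⟧ (+ k) s = trans (⟦≡ᵇ⟧ k (suc s)) (trans (sym (+-identityʳ _))
  (cong (_+_ (δ (+ suc s - + k))) (sym (trans (cong δ (lem (+ suc s) (+ k))) (δ-neg (+ suc (s ℕ.+ k)))))))
  where
  lem : ∀ s k → - s - k ≡ - (s + k)
  lem = solve-∀
⟦∣x∣≡ᵇs⟧ -[1+ k ] s = trans (⟦≡ᵇ⟧ (suc k) (suc s)) (trans (sym (+-identityˡ _))
  (cong (_+_ (+ 0)) (trans (sym (δ-neg (+ suc s - + suc k))) (cong δ (lem (+ suc s) (+ suc k))))))
  where
  lem : ∀ s k → - (s - k) ≡ - s - - k
  lem = solve-∀

∑-pick : ∀ n q (g : ℤ → ℤ) → ℤ.∣ q ∣ ℕ.≤ n →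
  ∑ (range (- + n) (suc (n ℕ.+ n))) (λ x → g x * δ (q - x)) ≡ g q
∑-pick n q g q≤n with ∣q∣≤h⇒offset q n q≤n
... | i , i<len , refl = trans (∑-range (suc (n ℕ.+ n)) (- + n) (λ x → g x * δ (- + n + + i - x))) (S-pick (suc (n ℕ.+ n)) (- + n) i g i<len)

∑-∣x∣≡s : ∀ n s (g : ℤ → ℤ) → Between n s →
  ∑ (range (- + n) (suc (n ℕ.+ n))) (λ x → ⟦ ℤ.∣ x ∣ ℕ.≡ᵇ s ⟧ * g x) ≡ g (+ s) + g (- + s)
∑-∣x∣≡s n (suc s) g (_ , s≤n) = begin
  ∑ L (λ x → ⟦ ℤ.∣ x ∣ ℕ.≡ᵇ suc s ⟧ * g x)
    ≡⟨ ∑-cong L (λ x → trans (cong (_* g x) (⟦∣x∣≡ᵇs⟧ x s)) (lem (δ (+ suc s - x)) (δ (- + suc s - x)) (g x))) ⟩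
  ∑ L (λ x → g x * δ (+ suc s - x) + g x * δ (- + suc s - x))
    ≡⟨ ∑-+ L (λ x → g x * δ (+ suc s - x)) (λ x → g x * δ (- + suc s - x)) ⟩
  ∑ L (λ x → g x * δ (+ suc s - x)) + ∑ L (λ x → g x * δ (- + suc s - x))
    ≡⟨ cong₂ _+_ (∑-pick n (+ suc s) g s≤n) (∑-pick n (- + suc s) g s≤n) ⟩
  g (+ suc s) + g (- + suc s) ∎
  where
  L : List ℤ
  L = range (- + n) (suc (n ℕ.+ n))
  lem : ∀ a b g → (a + b) * g ≡ g * a + g * b
  lem = solve-∀

-- Turns the filter over all words into the recursive enumeration: by `arranges-∷` the first letter
-- fixes the remaining set, and after exchanging the sums each absolute value contributes its two
-- signs.
∑-arranges : ∀ n m xs (f : List ℤ → ℤ) → Good n m xs →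
  ∑ (tuples m (range (- + n) (suc (n ℕ.+ n)))) (λ w → ⟦ arranges m xs w ⟧ * f w) ≡ Arr m xs f
∑-arranges n zero    xs f good = trans (+-identityʳ _) (ℤₚ.*-identityˡ (f []))
∑-arranges n (suc m) xs f good@(_ , sorted , _) = begin
  ∑ (tuples (suc m) L) (λ w → ⟦ arranges (suc m) xs w ⟧ * f w)
    ≡⟨ ∑-tuples m L _ ⟩
  ∑ L (λ x → ∑ W (λ w → ⟦ arranges (suc m) xs (x ∷ w) ⟧ * f (x ∷ w)))
    ≡⟨ ∑-cong L expand ⟩
  ∑ L (λ x → ∑ (picks xs) (λ p → ⟦ ℤ.∣ x ∣ ℕ.≡ᵇ proj₁ p ⟧ * ∑ W (λ w → ⟦ arranges m (proj₂ p) w ⟧ * f (x ∷ w))))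
    ≡⟨ ∑-swap L (picks xs) _ ⟩
  ∑ (picks xs) (λ p → ∑ L (λ x → ⟦ ℤ.∣ x ∣ ℕ.≡ᵇ proj₁ p ⟧ * ∑ W (λ w → ⟦ arranges m (proj₂ p) w ⟧ * f (x ∷ w))))
    ≡⟨ ∑-congAll (All.map (λ { {s , ys} (s∈ , good′) → trans (∑-∣x∣≡s n s _ s∈)
         (cong₂ _+_ (∑-arranges n m ys (λ w → f (+ s ∷ w)) good′)
                    (∑-arranges n m ys (λ w → f (- + s ∷ w)) good′)) })
       (picks-Good good)) ⟩
  Arr (suc m) xs f ∎
  where
  L : List ℤ
  L = range (- + n) (suc (n ℕ.+ n))
  W : List (List ℤ)
  W = tuples m L
  expand : ∀ x → ∑ W (λ w → ⟦ arranges (suc m) xs (x ∷ w) ⟧ * f (x ∷ w))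
    ≡ ∑ (picks xs) (λ p → ⟦ ℤ.∣ x ∣ ℕ.≡ᵇ proj₁ p ⟧ * ∑ W (λ w → ⟦ arranges m (proj₂ p) w ⟧ * f (x ∷ w)))
  expand x = begin
    ∑ W (λ w → ⟦ arranges (suc m) xs (x ∷ w) ⟧ * f (x ∷ w))
      ≡⟨ ∑-cong W (λ w → begin
           ⟦ arranges (suc m) xs (x ∷ w) ⟧ * f (x ∷ w)
             ≡⟨ cong (_* f (x ∷ w)) (arranges-∷ m xs x w sorted) ⟩
           ∑ (picks xs) (λ p → ⟦ ℤ.∣ x ∣ ℕ.≡ᵇ proj₁ p ⟧ * ⟦ arranges m (proj₂ p) w ⟧) * f (x ∷ w)
             ≡⟨ ℤₚ.*-comm _ (f (x ∷ w)) ⟩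
           f (x ∷ w) * ∑ (picks xs) (λ p → ⟦ ℤ.∣ x ∣ ℕ.≡ᵇ proj₁ p ⟧ * ⟦ arranges m (proj₂ p) w ⟧)
             ≡⟨ sym (∑-*ˡ (picks xs) (f (x ∷ w)) _) ⟩
           ∑ (picks xs) (λ p → f (x ∷ w) * (⟦ ℤ.∣ x ∣ ℕ.≡ᵇ proj₁ p ⟧ * ⟦ arranges m (proj₂ p) w ⟧))
             ≡⟨ ∑-cong (picks xs) (λ p → lem (f (x ∷ w)) ⟦ ℤ.∣ x ∣ ℕ.≡ᵇ proj₁ p ⟧ ⟦ arranges m (proj₂ p) w ⟧) ⟩
           ∑ (picks xs) (λ p → ⟦ ℤ.∣ x ∣ ℕ.≡ᵇ proj₁ p ⟧ * (⟦ arranges m (proj₂ p) w ⟧ * f (x ∷ w))) ∎) ⟩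
    ∑ W (λ w → ∑ (picks xs) (λ p → ⟦ ℤ.∣ x ∣ ℕ.≡ᵇ proj₁ p ⟧ * (⟦ arranges m (proj₂ p) w ⟧ * f (x ∷ w))))
      ≡⟨ ∑-swap W (picks xs) _ ⟩
    ∑ (picks xs) (λ p → ∑ W (λ w → ⟦ ℤ.∣ x ∣ ℕ.≡ᵇ proj₁ p ⟧ * (⟦ arranges m (proj₂ p) w ⟧ * f (x ∷ w))))
      ≡⟨ ∑-cong (picks xs) (λ p → ∑-*ˡ W ⟦ ℤ.∣ x ∣ ℕ.≡ᵇ proj₁ p ⟧ _) ⟩
    ∑ (picks xs) (λ p → ⟦ ℤ.∣ x ∣ ℕ.≡ᵇ proj₁ p ⟧ * ∑ W (λ w → ⟦ arranges m (proj₂ p) w ⟧ * f (x ∷ w))) ∎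
    where
    lem : ∀ f a b → f * (a * b) ≡ a * (b * f)
    lem = solve-∀

interval : ℕ → ℕ → List ℕ
interval s zero    = []
interval s (suc m) = s ∷ interval (suc s) m

interval-length : ∀ s m → length (interval s m) ≡ m
interval-length s zero    = refl
interval-length s (suc m) = cong suc (interval-length (suc s) m)

interval-All : ∀ s m → All (λ t → s ℕ.≤ t × t ℕ.< s ℕ.+ m) (interval s m)
interval-All s zero    = []
interval-All s (suc m) = (ℕₚ.≤-refl , ℕₚ.m<m+n s ℕ.z<s) ∷
  All.map (λ { {t} (s<t , t<) → ℕₚ.<⇒≤ s<t , subst (t ℕ.<_) (sym (ℕₚ.+-suc s m)) t< }) (interval-All (suc s) m)

interval-Sorted : ∀ s m → Sorted (interval s m)
interval-Sorted s zero    = []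
interval-Sorted s (suc m) = All.map proj₁ (interval-All (suc s) m) ∷ interval-Sorted (suc s) m

interval-Good : ∀ n → Good n n (interval 1 n)
interval-Good n = interval-length 1 n , interval-Sorted 1 n ,
  All.map (λ (1≤t , t<) → 1≤t , ℕ.s≤s⁻¹ t<) (interval-All 1 n)

member⇒ : ∀ {P : ℕ → Set} a xs → All P xs → T (member a xs) → P a
member⇒ {P} a (s ∷ xs) (p ∷ ps) a∈ with a ℕ.≡ᵇ s in eq
... | true  = subst P (sym (≡ᵇ-true {a} {s} eq)) p
... | false = member⇒ a xs ps a∈

⇒member-interval : ∀ a s m → s ℕ.≤ a → a ℕ.< s ℕ.+ m → T (member a (interval s m))
⇒member-interval a s zero    s≤a a< = contradiction (subst (a ℕ.<_) (ℕₚ.+-identityʳ s) a<) (ℕₚ.≤⇒≯ s≤a)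
⇒member-interval a s (suc m) s≤a a< with a ℕ.≡ᵇ s in eq
... | true  = tt
... | false = ⇒member-interval a (suc s) m
  (ℕₚ.≤∧≢⇒< s≤a (λ { refl → contradiction (trans (sym eq) (≡ᵇ-refl a)) λ () }))
  (subst (a ℕ.<_) (ℕₚ.+-suc s m) a<)

T-ext : ∀ {a b} → (T a → T b) → (T b → T a) → a ≡ b
T-ext {true}  {true}  f g = refl
T-ext {true}  {false} f g = contradiction (f tt) id
T-ext {false} {true}  f g = contradiction (g tt) id
T-ext {false} {false} f g = refl

member-interval : ∀ a n → member a (interval 1 n) ≡ (1 ℕ.≤ᵇ a) ∧ (a ℕ.≤ᵇ n)
member-interval zero    n = T-ext (λ a∈ → contradiction (proj₁ (member⇒ 0 _ (interval-All 1 n) a∈)) λ ()) λ ()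
member-interval (suc a) n = T-ext
  (λ a∈ → ℕₚ.≤⇒≤ᵇ (ℕ.s≤s⁻¹ (proj₂ (member⇒ (suc a) _ (interval-All 1 n) a∈))))
  (λ a≤n → ⇒member-interval (suc a) 1 n (ℕ.s≤s ℕ.z≤n) (ℕ.s≤s (ℕₚ.≤ᵇ⇒≤ (suc a) n a≤n)))

Abar≡eulerianB : ∀ n j → + Abar n j ≡ eulerianB n (+ j)
Abar≡eulerianB n j = begin
  + Abar n j
    ≡⟨ +count≡∑ _ (signedPerms n) ⟩
  ∑ (signedPerms n) (λ w → ⟦ desc n w ℕ.≡ᵇ j ⟧)
    ≡⟨ ∑-cong (signedPerms n) (λ w → ⟦≡ᵇ⟧ (desc n w) j) ⟩
  ∑ (signedPerms n) (λ w → δ (+ j - + desc n w))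
    ≡⟨ ∑-filter (isSignedPerm n) (tuples n (range (- + n) (suc (2 ℕ.* n)))) (λ w → δ (+ j - + desc n w)) ⟩
  ∑ (tuples n (range (- + n) (suc (2 ℕ.* n)))) (λ w → ⟦ isSignedPerm n w ⟧ * δ (+ j - + desc n w))
    ≡⟨ cong (λ k → ∑ (tuples n (range (- + n) (suc (n ℕ.+ k)))) (λ w → ⟦ isSignedPerm n w ⟧ * δ (+ j - + desc n w)))
         (ℕₚ.+-identityʳ n) ⟩
  ∑ (tuples n L) (λ w → ⟦ isSignedPerm n w ⟧ * δ (+ j - + desc n w))
    ≡⟨ ∑-cong (tuples n L) (λ w → cong (λ b → ⟦ (length w ℕ.≡ᵇ n) ∧ b ∧ distinct (map ℤ.∣_∣ w) ⟧ * δ (+ j - + desc n w)) (all≡ w)) ⟩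
  ∑ (tuples n L) (λ w → ⟦ arranges n (interval 1 n) w ⟧ * δ (+ j - + desc n w))
    ≡⟨ ∑-arranges n n (interval 1 n) _ (interval-Good n) ⟩
  Arr n (interval 1 n) (λ w → δ (+ j - + desc n w))
    ≡⟨ Arr-desc≡eulerianB n n (interval 1 n) (+ j) (interval-Good n) ⟩
  eulerianB n (+ j) ∎
  where
  L : List ℤ
  L = range (- + n) (suc (n ℕ.+ n))
  all≡ : ∀ w → all (λ x → (1 ℕ.≤ᵇ ℤ.∣ x ∣) ∧ (ℤ.∣ x ∣ ℕ.≤ᵇ n)) w ≡ lettersIn (interval 1 n) w
  all≡ []      = refl
  all≡ (x ∷ w) = cong₂ _∧_ (sym (member-interval ℤ.∣ x ∣ n)) (all≡ w)

-- The limit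

half-even : ∀ n → (∃ λ m → n ≡ 2 ℕ.* m) → n ≡ ⌊ n /2⌋ ℕ.+ ⌊ n /2⌋
half-even n (m , refl) rewrite ℕₚ.+-identityʳ m = cong (λ k → k ℕ.+ k) (ℕₚ.n≡⌊n+n/2⌋ m)

half-odd : ∀ b → (∃ λ c → b ≡ 2 ℕ.* c ℕ.+ 1) → b ≡ suc (⌊ b /2⌋ ℕ.+ ⌊ b /2⌋)
half-odd b (c , refl) rewrite ℕₚ.+-identityʳ c | ℕₚ.+-comm (c ℕ.+ c) 1 =
  cong (λ k → suc (k ℕ.+ k)) (ℕₚ.n≡⌈n+n/2⌉ c)

r<b^r : ∀ b r → 3 ℕ.≤ b → r ℕ.< b ℕ.^ r
r<b^r b zero    _   = ℕ.s≤s ℕ.z≤n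
r<b^r b (suc r) 3≤b = ℕₚ.≤-trans
  (ℕₚ.≤-trans (ℕₚ.+-mono-≤ (ℕₚ.≤-trans (ℕ.s≤s ℕ.z≤n) (r<b^r b r 3≤b)) (r<b^r b r 3≤b))
    (ℕₚ.+-monoʳ-≤ (b ℕ.^ r) (ℕₚ.m≤m+n (b ℕ.^ r) 0)))
  (ℕₚ.*-monoˡ-≤ (b ℕ.^ r) (ℕₚ.≤-trans (ℕₚ.n≤1+n 2) 3≤b))

-- Cross-multiplication, done on unnormalised fractions, where numerators and denominators are
-- explicit.
÷ℕ-close : ∀ x y d e p q .{cp : Coprime (suc p) (suc q)} .{{_ : ℕ.NonZero d}} .{{_ : ℕ.NonZero e}} →
  ℤ.∣ x * + e - y * + d ∣ ℕ.* suc q ℕ.< suc p ℕ.* (d ℕ.* e) →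
  ℚ.∣ (x ÷ℕ d) ℚ.- (y ÷ℕ e) ∣ ℚ.< mkℚ (+ suc p) q cp
÷ℕ-close x y (suc d) (suc e) p q lt = ℚₚ.toℚᵘ-cancel-< (ℚᵘₚ.<-respˡ-≃ (ℚᵘₚ.≃-sym eq)
  (*<* (subst₂ ℤ._<_
    (trans (ℤₚ.pos-* ℤ.∣ x * + suc e - y * + suc d ∣ (suc q))
      (cong (λ v → + ℤ.∣ x * + suc e + v ∣ * + suc q) (ℤₚ.neg-distribˡ-* y (+ suc d))))
    (ℤₚ.pos-* (suc p) (suc d ℕ.* suc e))
    (ℤ.+<+ lt))))
  where
  X Y : ℚ
  X = x ÷ℕ suc d
  Y = y ÷ℕ suc e
  eq : ℚ.toℚᵘ (ℚ.∣ X ℚ.- Y ∣) ℚᵘ.≃ ℚᵘ.∣ mkℚᵘ x d ℚᵘ.- mkℚᵘ y e ∣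
  eq = ℚᵘₚ.≃-trans (ℚₚ.toℚᵘ-homo-∣-∣ (X ℚ.- Y)) (ℚᵘₚ.∣-∣-cong
    (ℚᵘₚ.≃-trans (ℚₚ.toℚᵘ-homo-+ X (ℚ.- Y))
      (ℚᵘₚ.+-cong (ℚₚ.toℚᵘ-fromℚᵘ (mkℚᵘ x d))
        (ℚᵘₚ.≃-trans (ℚₚ.toℚᵘ-homo‿- Y) (ℚᵘₚ.-‿cong (ℚₚ.toℚᵘ-fromℚᵘ (mkℚᵘ y e)))))))

theorem3p3 : (b n : ℕ) → 3 ℕ.≤ b → (∃ λ c → b ≡ 2 ℕ.* c ℕ.+ 1) →
  1 ℕ.≤ n → (∃ λ m → n ≡ 2 ℕ.* m) →
  (j : ℕ) → j ℕ.≤ n →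
  (ε : ℚ) → 0ℚ ℚ.< ε →
  ∃ λ R → (r : ℕ) → R ℕ.≤ r →
    ℚ.∣ Kpow b n r (+ 0) (+ j - + ⌊ n /2⌋) ℚ.- ((+ Abar n j) ÷ℕ (2 ℕ.^ n ℕ.* n !)) ∣ ℚ.< ε
theorem3p3 b n 3≤b odd _ even j _ (mkℚ (+ zero) q _) (ℚ.*<* (ℤ.+<+ ()))
-- Here ε = (p+1)/(q+1) ≥ 1/(q+1). The first term of the threshold brings C/N below 1/(q+1); the
-- second ensures h ≤ M, which the base case of the asymptotics requires.
theorem3p3 b n 3≤b odd _ even j _ ε@(mkℚ (+ suc p) q _) _ = C ℕ.* suc q ℕ.+ (h ℕ.+ h) , close
  where
  h C : ℕ
  h = ⌊ n /2⌋
  C = proj₁ (scaledSpline-asymptotics n h (+ j))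
  b≡ : b ≡ suc (⌊ b /2⌋ ℕ.+ ⌊ b /2⌋)
  b≡ = half-odd b odd
  n≡ : n ≡ h ℕ.+ h
  n≡ = half-even n even
  close : ∀ r → C ℕ.* suc q ℕ.+ (h ℕ.+ h) ℕ.≤ r →
    ℚ.∣ Kpow b n r (+ 0) (+ j - + h) ℚ.- ((+ Abar n j) ÷ℕ scale n) ∣ ℚ.< ε
  close r large = subst (λ v → ℚ.∣ v ℚ.- ((+ Abar n j) ÷ℕ scale n) ∣ ℚ.< ε)
    (sym (trans (Kpow≡spline b n r (+ j - + h) b≡ n≡) (cong (λ t → spline N (suc n) t ÷ℕ P) centre)))
    (÷ℕ-close x (+ Abar n j) P (scale n) p q small)
    where
    N M P : ℕ
    N = b ℕ.^ r
    M = half-width b r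
    P = N ℕ.^ n
    N≡ : N ≡ suc (M ℕ.+ M)
    N≡ = b^r≡1+2·half-width b r b≡
    x : ℤ
    x = spline N (suc n) (point N M h (+ j))
    instance
      N≢0 : ℕ.NonZero N
      N≢0 = subst ℕ.NonZero (sym N≡) _
      P≢0 : ℕ.NonZero P
      P≢0 = ℕₚ.m^n≢0 N n
      2^n≢0 : ℕ.NonZero (2 ℕ.^ n)
      2^n≢0 = ℕₚ.m^n≢0 2 n
      n!≢0 : ℕ.NonZero (n !)
      n!≢0 = n ℕₚ.!≢0
      scale≢0 : ℕ.NonZero (scale n)
      scale≢0 = ℕₚ.m*n≢0 (2 ℕ.^ n) (n !)
    centre : - (+ suc n * + M) - (+ j - + h) * + N ≡ point N M h (+ j)
    centre = subst₂ (λ n N → - (+ suc n * + M) - (+ j - + h) * + N ≡ point N M h (+ j)) (sym n≡) (sym N≡)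
      (lem (+ h) (+ M) (+ j))
      where
      lem : ∀ h M j → let N = + 1 + (M + M) in
        - ((+ 1 + (h + h)) * M) - (j - h) * N ≡ - (j * N + M - h)
      lem = solve-∀
    r<N : r ℕ.< N
    r<N = r<b^r b r 3≤b
    h≤M : h ℕ.≤ M
    h≤M with h ℕ.≤? M
    ... | yes h≤M = h≤M
    ... | no  h≰M = contradiction
      (ℕₚ.≤-trans (ℕₚ.≤-trans (ℕₚ.m≤n+m (h ℕ.+ h) (C ℕ.* suc q)) large) (ℕₚ.<⇒≤ r<N))
      (ℕₚ.<⇒≱ (subst (ℕ._< h ℕ.+ h) (sym N≡)
        (ℕₚ.≤-trans (ℕ.s≤s (ℕₚ.≤-reflexive (sym (ℕₚ.+-suc M M)))) (ℕₚ.+-mono-≤ (ℕₚ.≰⇒> h≰M) (ℕₚ.≰⇒> h≰M)))))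
    d : ℕ
    d = ℤ.∣ x * + scale n - + Abar n j * + P ∣
    N*d≤C*P : N ℕ.* d ℕ.≤ C ℕ.* P
    N*d≤C*P = subst (ℕ._≤ C ℕ.* P)
      (trans (cong (λ v → ℤ.∣ + N * (v - eulerianB n (+ j) * + P) ∣) (ℤₚ.*-comm (+ scale n) x))
        (trans (cong (λ v → ℤ.∣ + N * (x * + scale n - v * + P) ∣) (sym (Abar≡eulerianB n j)))
          (ℤₚ.abs-* (+ N) (x * + scale n - + Abar n j * + P))))
      (proj₂ (scaledSpline-asymptotics n h (+ j)) N M (M ℕ.∸ h) N≡ (sym (ℕₚ.m+[n∸m]≡n h≤M)))
    small : d ℕ.* suc q ℕ.< suc p ℕ.* (P ℕ.* scale n)
    small = ℕₚ.<-≤-trans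
      -- From d/P ≤ C/N and C(q+1) ≤ r < N follows d(q+1) < P.
      (cancel-bound N d C P (suc q) r N*d≤C*P (ℕₚ.≤-trans (ℕₚ.m≤m+n (C ℕ.* suc q) (h ℕ.+ h)) large) r<N)
      (ℕₚ.≤-trans (ℕₚ.m≤m*n P (scale n)) (ℕₚ.m≤m+n (P ℕ.* scale n) (p ℕ.* (P ℕ.* scale n))))
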